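{- In the cell-probe model with $w$ bits per cell, there exist instances of the online Hamming distance problem (with parameters $n$ and $\delta$) such that any algorithm solving it has expected amortised time $\Omega\left(\frac{\delta}{w}\log n\right)$ per arriving symbol. This holds for randomised algorithms as well as deterministic ones.
   Context: Online Hamming distance problem: parameters are positive integers $n$ and $\delta$, an alphabet $\Sigma$ with $|\Sigma|\le 2^\delta$ (so $\delta$ is the number of bits needed to represent a symbol), and a fixed string $F\in\Sigma^n$. The algorithm maintains a string $S\in\Sigma^n$ subject to an operation $\mathrm{arrive}(x)$, $x\in\Sigma$, which removes the leftmost symbol $S[0]$, appends $x$ to the right of $S[n-1]$, and must then output the Hamming distance between $F$ and the updated $S$ (the number of positions $i$ with $F[i]\neq S[i]$), before the next symbol arrives. Cell-probe model: memory consists of cells of $w$ bits each, with $w\ge \log_2 n$; computation is free and the cost is the number of cells read or written (cell probes); the computing unit retains no information between operations. Time is measured as the number of cell probes.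
   Formalization: Proved for 1 ≤ δ ≤ log₂ n and large n (for unbounded δ the claim fails, since F has at most n distinct symbols); memory has 2^w cells; a randomised algorithm is a uniform choice among finitely many always-correct deterministic algorithms. -}

module Defs where

open import Data.Nat using (ℕ; zero; suc; _+_; _^_)
open import Data.Bool using (Bool; true; false; if_then_else_)
open import Data.Fin using (Fin; _≟_)
open import Data.Vec using (Vec; []; _∷_; _∷ʳ_)
open import Data.List using (List; []; _∷_)
open import Data.Product using (_×_; _,_)
open import Relation.Nullary.Decidable using (does)
open import Relation.Binary.PropositionalEquality using (_≡_)

Sym : ℕ → Set
Sym δ = Fin (2 ^ δ)

Word : ℕ → Set
Word w = Vec Bool w

Addr : ℕ → Set
Addr w = Fin (2 ^ w)

Mem : ℕ → Set
Mem w = Addr w → Word w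

-- The (adaptive) cell-probe program executed for one operation.
-- Computation is free: the next step may depend arbitrarily on the
-- contents of cells read so far. Each read and each write is one probe.
-- The program ends by outputting a natural number (the answer).
data Prog (w : ℕ) : Set where
  read  : Addr w → (Word w → Prog w) → Prog w
  write : Addr w → Word w → Prog w → Prog w
  out   : ℕ → Prog w

updateMem : ∀ {w} → Mem w → Addr w → Word w → Mem w
updateMem m a v b = if does (a ≟ b) then v else m b

exec : ∀ {w} → Prog w → Mem w → Mem w × ℕ × ℕ
exec (read a k)    m with exec (k (m a)) m
... | m' , o , c = m' , o , suc c
exec (write a v p) m with exec p (updateMem m a v)
... | m' , o , c = m' , o , suc c
exec (out o)       m = m , o , 0

-- A deterministic cell-probe algorithm for the online problem over alphabet
-- Sym δ: an initial memory (arbitrary preprocessing, free) and, for each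
-- arriving symbol x, the program run for arrive(x). The computing unit keeps
-- no state between operations, so the program depends only on x.
record Algorithm (δ w : ℕ) : Set where
  field
    initMem : Mem w
    arrive  : Sym δ → Prog w
open Algorithm public

runFrom : ∀ {δ w} → Algorithm δ w → Mem w → List (Sym δ) → List ℕ × ℕ
runFrom A m []       = [] , 0
runFrom A m (x ∷ xs) with exec (arrive A x) m
... | m' , o , c with runFrom A m' xs
...   | os , c' = o ∷ os , c + c'

outputs : ∀ {δ w} → Algorithm δ w → List (Sym δ) → List ℕ
outputs A xs with runFrom A (initMem A) xs
... | os , _ = os

cost : ∀ {δ w} → Algorithm δ w → List (Sym δ) → ℕ
cost A xs with runFrom A (initMem A) xs
... | _ , c = c

hamming : ∀ δ {n} → Vec (Sym δ) n → Vec (Sym δ) n → ℕ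
hamming δ []       []       = 0
hamming δ (f ∷ fs) (s ∷ ss) = (if does (f ≟ s) then 0 else 1) + hamming δ fs ss

shift : ∀ {A : Set} {n} → Vec A n → A → Vec A n
shift []       x = []
shift (s ∷ ss) x = ss ∷ʳ x

hammingOutputs : ∀ δ {n} → Vec (Sym δ) n → Vec (Sym δ) n → List (Sym δ) → List ℕ
hammingOutputs δ F S []       = []
hammingOutputs δ F S (x ∷ xs) = hamming δ F (shift S x) ∷ hammingOutputs δ F (shift S x) xs

Solves : ∀ {δ w n} → Vec (Sym δ) n → Vec (Sym δ) n → Algorithm δ w → Set
Solves {δ} F S₀ A = ∀ xs → outputs A xs ≡ hammingOutputs δ F S₀ xs

sumFin : ∀ k → (Fin k → ℕ) → ℕ
sumFin zero    f = 0
sumFin (suc k) f = f Fin.zero + sumFin k (λ i → f (Fin.suc i))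

{-# OPTIONS --safe #-}
module Submission where

-- By averaging it suffices to bound the total cost of a deterministic algorithm
-- over a finite family of inputs. In a binary tree of periods, charge a probe
-- reading a cell to the node whose left half contains the last write to the
-- cell and whose right half contains the read. The cells charged to a node
-- determine the outputs of its right half, given everything but its left half,
-- so it is enough that these outputs determine Ω(δ ℓ) bits of a left half of
-- length ℓ.
--
-- To this end the fixed string has, for every level of the tree, short patterns
-- at about distance ℓ from its right end, and is blank elsewhere. A block of
-- m = 2 ^ k input symbols meets m test patterns, one at a time. A nonblank
-- symbol consists of its position modulo m and a value, so that misaligned
-- blocks never match. The values shown by the tests to the cells of a block
-- form a Lindström detecting matrix, which recovers m values of Ω(k) bits from
-- only m counts. For bounded δ, blocks 01 and 10 read by single marks suffice.

-- A count of mismatches over the `m` cells of a block is worth only about `k` bits. Recovering Ω(δ)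
-- bits per output therefore forces `k` = Ω(δ), hence blocks of length exponential in δ, while every
-- useful level of the tree must span several blocks. The hypothesis δ ≤ log n makes this
-- affordable: with `k` about δ / 8, at least half of the levels remain. A single comparison tells
-- only whether a cell holds the displayed value. So a value `v` is displayed on exactly `v` of the
-- possible traces `A ∩ C` of tests `A` on a large cell `C`, and it is recovered as a number of
-- matches; the detecting matrix separates the contributions of different cells.

open import Defs
open import Algebra.Bundles using (module AbelianGroup)
open import Data.Bool using (Bool; true; false; _∧_; _∨_; _xor_; not; if_then_else_)
open import Data.Bool.Properties using (∨-zeroʳ; ∨-identityʳ; not-involutive)
open import Data.Fin using (Fin; toℕ; fromℕ<; combine; remQuot; _↑ˡ_; _↑ʳ_) renaming (_≟_ to _≟ᶠ_)
open import Data.Fin.Properties using (toℕ<n; toℕ-injective; fromℕ<-injective; combine-injective; remQuot-combine; combine-remQuot) renaming (suc-injective to Fin-suc-injective)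
open import Data.Integer as ℤ using (ℤ; -_; 1ℤ; -1ℤ) renaming (+_ to pos)
import Data.Integer.Properties as ℤ
import Data.Integer.Tactic.RingSolver as ℤ-Solver
open import Algebra.Properties.Group (AbelianGroup.group ℤ.+-0-abelianGroup) using () renaming (∙-cancelʳ to +ℤ-cancelʳ)
open import Data.List using (List; []; _∷_; _++_; length; map; replicate)
open import Data.List.Properties using (++-assoc; length-++; length-map; length-replicate; map-injective; ∷-injectiveˡ; ∷-injectiveʳ)
open import Data.List.Relation.Unary.All as All using (All; []; _∷_)
open import Data.List.Relation.Unary.All.Properties using (++⁺)
open import Data.Maybe using (Maybe; just; nothing)
open import Data.Nat using (ℕ; zero; suc; _+_; _*_; _^_; _∸_; _/_; _%_; ⌊_/2⌋; _≤_; _<_; z≤n; s≤s; _≟_; _<?_; _≤?_; NonZero; >-nonZero)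
open import Data.Nat.DivMod using (m≡m%n+[m/n]*n; m%n<n; m<n⇒m%n≡m; [m+kn]%n≡m%n)
open import Data.Nat.Logarithm using (⌊log₂_⌋; ⌊log₂[2^n]⌋≡n; ⌊log₂⌋-mono-≤; ⌊log₂⌊n/2⌋⌋≡⌊log₂n⌋∸1)
open import Data.Nat.Properties
open import Data.Nat.Tactic.RingSolver using (solve-∀)
open import Data.Product using (Σ; ∃; _×_; _,_; proj₁; proj₂)
open import Data.Sum using (_⊎_; inj₁; inj₂)
open import Data.Vec using (Vec; []; _∷_; _∷ʳ_; toList; fromList) renaming (map to mapᵛ)
open import Data.Vec.Properties using (toList∘fromList)
open import Relation.Binary using (tri<; tri≈; tri>)
open import Relation.Binary.PropositionalEquality
open import Relation.Nullary using (¬_; Dec; yes; no; does; contradiction)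
open import Relation.Nullary.Decidable using (_×-dec_; ¬?)

-- Sums and counting

sumFin-cong : ∀ n {f g : Fin n → ℕ} → (∀ i → f i ≡ g i) → sumFin n f ≡ sumFin n g
sumFin-cong zero    eq = refl
sumFin-cong (suc n) eq = cong₂ _+_ (eq Fin.zero) (sumFin-cong n (λ i → eq (Fin.suc i)))

sumFin-mono : ∀ n {f g : Fin n → ℕ} → (∀ i → f i ≤ g i) → sumFin n f ≤ sumFin n g
sumFin-mono zero    le = z≤n
sumFin-mono (suc n) le = +-mono-≤ (le Fin.zero) (sumFin-mono n (λ i → le (Fin.suc i)))

sumFin-const : ∀ n c → sumFin n (λ _ → c) ≡ n * c
sumFin-const zero    c = refl
sumFin-const (suc n) c = cong (c +_) (sumFin-const n c)

sumFin-+ : ∀ n (f g : Fin n → ℕ) → sumFin n (λ i → f i + g i) ≡ sumFin n f + sumFin n g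
sumFin-+ zero    f g = refl
sumFin-+ (suc n) f g =
  trans (cong (f Fin.zero + g Fin.zero +_) (sumFin-+ n _ _))
        (interchange (f Fin.zero) (g Fin.zero) _ _)
  where
  interchange : ∀ a b c d → (a + b) + (c + d) ≡ (a + c) + (b + d)
  interchange = solve-∀

sumFin-* : ∀ n c (f : Fin n → ℕ) → sumFin n (λ i → c * f i) ≡ c * sumFin n f
sumFin-* zero    c f = sym (*-zeroʳ c)
sumFin-* (suc n) c f =
  trans (cong (c * f Fin.zero +_) (sumFin-* n c _)) (sym (*-distribˡ-+ c (f Fin.zero) _))

sumFin-swap : ∀ a b (f : Fin a → Fin b → ℕ) →
  sumFin a (λ i → sumFin b (f i)) ≡ sumFin b (λ j → sumFin a (λ i → f i j))
sumFin-swap zero    b f = sym (trans (sumFin-const b 0) (*-zeroʳ b))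
sumFin-swap (suc a) b f =
  trans (cong (sumFin b (f Fin.zero) +_) (sumFin-swap a b (λ i → f (Fin.suc i))))
        (sym (sumFin-+ b (f Fin.zero) _))

sumFin-split : ∀ a b (f : Fin (a + b) → ℕ) →
  sumFin (a + b) f ≡ sumFin a (λ i → f (i ↑ˡ b)) + sumFin b (λ j → f (a ↑ʳ j))
sumFin-split zero    b f = refl
sumFin-split (suc a) b f =
  trans (cong (f Fin.zero +_) (sumFin-split a b (λ i → f (Fin.suc i))))
        (sym (+-assoc (f Fin.zero) _ _))

sumFin-combine : ∀ a b (f : Fin (a * b) → ℕ) →
  sumFin (a * b) f ≡ sumFin a (λ i → sumFin b (λ j → f (combine i j)))
sumFin-combine zero    b f = refl
sumFin-combine (suc a) b f =
  trans (sumFin-split b (a * b) f)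
        (cong (sumFin b (λ j → f (j ↑ˡ (a * b))) +_) (sumFin-combine a b (λ i → f (b ↑ʳ i))))

average : ∀ n (f : Fin n → ℕ) B → 0 < n → n * B ≤ sumFin n f → ∃ λ i → B ≤ f i
average (suc n) f B _ le with B ≤? f Fin.zero
... | yes p = Fin.zero , p
average (suc zero) f B _ le | no B≰ =
  contradiction (subst₂ _≤_ (+-identityʳ B) (+-identityʳ _) le) B≰
average (suc (suc n)) f B _ le | no B≰
  with average (suc n) (λ i → f (Fin.suc i)) B (s≤s z≤n) tail≤
  where
  tail≤ : suc n * B ≤ sumFin (suc n) (λ i → f (Fin.suc i))
  tail≤ = +-cancelˡ-≤ B _ _ (≤-trans le (+-monoˡ-≤ _ (<⇒≤ (≰⇒> B≰))))
... | i , p = Fin.suc i , p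

InjectiveCode : ∀ {n} → (Fin n → ℕ) → Set
InjectiveCode g = ∀ i j → g i ≡ g j → i ≡ j

if-true : ∀ {P A : Set} (d : Dec P) {x y : A} → P → (if does d then x else y) ≡ x
if-true (yes _) _ = refl
if-true (no ¬p) p = contradiction p ¬p

if-false : ∀ {P A : Set} (d : Dec P) {x y : A} → ¬ P → (if does d then x else y) ≡ y
if-false (yes p) ¬p = contradiction p ¬p
if-false (no _)  _  = refl

𝟙 : ∀ {P : Set} → Dec P → ℕ
𝟙 d = if does d then 1 else 0

fibre≤1 : ∀ n (g : Fin n → ℕ) → InjectiveCode g → ∀ K → sumFin n (λ i → 𝟙 (g i ≟ K)) ≤ 1
fibre≤1 zero    g inj K = z≤n
fibre≤1 (suc n) g inj K with g Fin.zero ≟ K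
... | no ¬p = subst (λ x → x + sumFin n (λ i → 𝟙 (g (Fin.suc i) ≟ K)) ≤ 1) (sym (if-false (g Fin.zero ≟ K) ¬p))
  (fibre≤1 n (λ i → g (Fin.suc i)) (λ i j eq → Fin-suc-injective (inj _ _ eq)) K)
... | yes p = ≤-reflexive (cong₂ _+_ (if-true (g Fin.zero ≟ K) p)
  (trans (sumFin-cong n (λ i → if-false (g (Fin.suc i) ≟ K) (miss i)))
         (trans (sumFin-const n 0) (*-zeroʳ n))))
  where
  miss : ∀ i → ¬ g (Fin.suc i) ≡ K
  miss i q with () ← inj _ _ (trans p (sym q))

below≤ : ∀ n (g : Fin n → ℕ) → InjectiveCode g → ∀ K → sumFin n (λ i → 𝟙 (g i <? K)) ≤ K
below≤ n g inj zero    = ≤-reflexive (trans (sumFin-const n 0) (*-zeroʳ n))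
below≤ n g inj (suc K) = begin
  sumFin n (λ i → 𝟙 (g i <? suc K))                            ≤⟨ sumFin-mono n (λ i → step (g i)) ⟩
  sumFin n (λ i → 𝟙 (g i ≟ K) + 𝟙 (g i <? K))                 ≡⟨ sumFin-+ n _ _ ⟩
  sumFin n (λ i → 𝟙 (g i ≟ K)) + sumFin n (λ i → 𝟙 (g i <? K)) ≤⟨ +-mono-≤ (fibre≤1 n g inj K) (below≤ n g inj K) ⟩
  suc K ∎
  where
  open ≤-Reasoning
  step : ∀ x → 𝟙 (x <? suc K) ≤ 𝟙 (x ≟ K) + 𝟙 (x <? K)
  step x with x <? suc K
  ... | no x≮ = ≤-trans (≤-reflexive (if-false (x <? suc K) x≮)) z≤n
  ... | yes x< with m≤n⇒m<n∨m≡n (≤-pred x<)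
  ...   | inj₁ lt = ≤-trans (≤-reflexive (trans (if-true (x <? suc K) x<) (sym (if-true (x <? K) lt)))) (m≤n+m _ _)
  ...   | inj₂ eq = ≤-trans (≤-reflexive (trans (if-true (x <? suc K) x<) (sym (if-true (x ≟ K) eq)))) (m≤m+n _ _)

-- At most half of the 2 ^ E arguments have a code below 2 ^ (E - 1);
-- all the others have length at least E / c.
code-length : ∀ {N} E → N ≡ 2 ^ E → ∀ c (len g : Fin N → ℕ) → InjectiveCode g →
  (∀ i → g i < 2 ^ (c * len i)) →
  N * E ≤ 2 * (c * sumFin N len)
code-length zero    refl c len g inj short = z≤n
code-length (suc E) refl c len g inj short = begin
  2 * K * suc E                 ≡⟨ *-assoc 2 K (suc E) ⟩
  2 * (K * suc E)               ≤⟨ *-monoʳ-≤ 2 half ⟩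
  2 * sumFin N (λ i → c * len i) ≡⟨ cong (2 *_) (sumFin-* N c len) ⟩
  2 * (c * sumFin N len)        ∎
  where
  open ≤-Reasoning
  K = 2 ^ E
  N = 2 ^ suc E
  -- A code of at least `K` forces `c * len i` to exceed `E`; a smaller code is paid for by the
  -- indicator, and at most `K` codes are smaller.
  pointwise : ∀ i → suc E ≤ c * len i + suc E * 𝟙 (g i <? K)
  pointwise i with g i <? K
  ... | yes g<K = ≤-trans
    (≤-reflexive (sym (trans (cong (suc E *_) (if-true (g i <? K) g<K)) (*-identityʳ (suc E)))))
    (m≤n+m _ (c * len i))
  ... | no g≮K = ≤-trans (≰⇒> {c * len i} {E} λ le → g≮K (<-≤-trans (short i) (^-monoʳ-≤ 2 le))) (m≤m+n (c * len i) _)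
  double : ∀ x e → (x + (x + 0)) * e ≡ x * e + e * x
  double = solve-∀
  half : K * suc E ≤ sumFin N (λ i → c * len i)
  half = +-cancelʳ-≤ (suc E * K) _ _ (begin
    K * suc E + suc E * K                          ≡⟨ double K (suc E) ⟨
    N * suc E                                      ≡⟨ sumFin-const N (suc E) ⟨
    sumFin N (λ _ → suc E)                         ≤⟨ sumFin-mono N pointwise ⟩
    sumFin N (λ i → c * len i + suc E * 𝟙 (g i <? K)) ≡⟨ sumFin-+ N _ _ ⟩
    sumFin N (λ i → c * len i) + sumFin N (λ i → suc E * 𝟙 (g i <? K))
      ≡⟨ cong (sumFin N (λ i → c * len i) +_) (sumFin-* N (suc E) _) ⟩
    sumFin N (λ i → c * len i) + suc E * sumFin N (λ i → 𝟙 (g i <? K))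
      ≤⟨ +-monoʳ-≤ (sumFin N (λ i → c * len i)) (*-monoʳ-≤ (suc E) (below≤ N g inj K)) ⟩
    sumFin N (λ i → c * len i) + suc E * K         ∎)

sumFin-lower : ∀ n c B (f : Fin n → ℕ) → (∀ i → B ≤ c * f i) → n * B ≤ c * sumFin n f
sumFin-lower n c B f le = begin
  n * B                    ≡⟨ sumFin-const n B ⟨
  sumFin n (λ _ → B)       ≤⟨ sumFin-mono n le ⟩
  sumFin n (λ i → c * f i) ≡⟨ sumFin-* n c f ⟩
  c * sumFin n f           ∎
  where open ≤-Reasoning

-- Runs of cell-probe algorithms

digits : ∀ b {x y p q} → x < b → y < b → x + b * p ≡ y + b * q → x ≡ y × p ≡ q
digits b {x} {y} {p} {q} x<b y<b eq = x≡y , *-cancelˡ-≡ p q b (+-cancelˡ-≡ y _ _ (trans (cong (_+ b * p) (sym x≡y)) eq))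
  where
  instance
    b≢0 : NonZero b
    b≢0 = >-nonZero (≤-<-trans z≤n x<b)
  low : ∀ z r → z < b → (z + b * r) % b ≡ z
  low z r z<b = trans (cong (λ s → (z + s) % b) (*-comm b r)) (trans ([m+kn]%n≡m%n z r b) (m<n⇒m%n≡m z<b))
  x≡y : x ≡ y
  x≡y = trans (sym (low x p x<b)) (trans (cong (_% b) eq) (low y q y<b))

module _ {w : ℕ} where

  data Event : Set where
    rd wr : Addr w → Word w → Event

  final : Prog w → Mem w → Mem w
  final (read a k)    m = final (k (m a)) m
  final (write a v p) m = final p (updateMem m a v)
  final (out o)       m = m

  answer : Prog w → Mem w → ℕ
  answer (read a k)    m = answer (k (m a)) m
  answer (write a v p) m = answer p (updateMem m a v)
  answer (out o)       m = o

  probes : Prog w → Mem w → List Event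
  probes (read a k)    m = rd a (m a) ∷ probes (k (m a)) m
  probes (write a v p) m = wr a v ∷ probes p (updateMem m a v)
  probes (out o)       m = []

  exec-spec : ∀ p m → exec p m ≡ (final p m , answer p m , length (probes p m))
  exec-spec (read a k)    m rewrite exec-spec (k (m a)) m = refl
  exec-spec (write a v p) m rewrite exec-spec p (updateMem m a v) = refl
  exec-spec (out o)       m = refl

  AddrSet : Set
  AddrSet = Addr w → Bool

  ∅ : AddrSet
  ∅ _ = false

  insert : Addr w → AddrSet → AddrSet
  insert a V b = does (a ≟ᶠ b) ∨ V b

  written : AddrSet → List Event → AddrSet
  written V []           = V
  written V (rd a v ∷ t) = written V t
  written V (wr a v ∷ t) = written (insert a V) t

  written-++ : ∀ V t u → written V (t ++ u) ≡ written (written V t) u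
  written-++ V []           u = refl
  written-++ V (rd a v ∷ t) u = written-++ V t u
  written-++ V (wr a v ∷ t) u = written-++ (insert a V) t u

  rereads : AddrSet → List Event → ℕ
  rereads V []           = 0
  rereads V (rd a v ∷ t) = (if V a then 1 else 0) + rereads V t
  rereads V (wr a v ∷ t) = rereads (insert a V) t

  rereads≤length : ∀ V t → rereads V t ≤ length t
  rereads≤length V []           = z≤n
  rereads≤length V (rd a v ∷ t) with V a
  ... | true  = s≤s (rereads≤length V t)
  ... | false = m≤n⇒m≤1+n (rereads≤length V t)
  rereads≤length V (wr a v ∷ t) = m≤n⇒m≤1+n (rereads≤length (insert a V) t)

  rereads-++ : ∀ V t u → rereads V (t ++ u) ≡ rereads V t + rereads (written V t) u
  rereads-++ V []           u = refl
  rereads-++ V (rd a v ∷ t) u =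
    trans (cong ((if V a then 1 else 0) +_) (rereads-++ V t u)) (sym (+-assoc (if V a then 1 else 0) _ _))
  rereads-++ V (wr a v ∷ t) u = rereads-++ (insert a V) t u

  Cells : Set
  Cells = List (Addr w × Word w)

  -- The information transfer of Pătraşcu and Demaine: the cells of W that are
  -- read before being overwritten; V is the set of cells overwritten so far.
  transfer : AddrSet → AddrSet → List Event → Cells
  transfer W V []           = []
  transfer W V (rd a v ∷ t) = if W a ∧ not (V a) then (a , v) ∷ transfer W V t else transfer W V t
  transfer W V (wr a v ∷ t) = transfer W (insert a V) t

  transfer-++ : ∀ W V t u → transfer W V (t ++ u) ≡ transfer W V t ++ transfer W (written V t) u
  transfer-++ W V []           u = refl
  transfer-++ W V (rd a v ∷ t) u with W a ∧ not (V a)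
  ... | true  = cong ((a , v) ∷_) (transfer-++ W V t u)
  ... | false = transfer-++ W V t u
  transfer-++ W V (wr a v ∷ t) u = transfer-++ W (insert a V) t u

  -- A read counted for `U` hits a cell of `V`, or a cell of `W` not yet overwritten, and the latter
  -- is exactly what `transfer` records. A write enlarges `U` and `V` alike, so `eq` persists.
  rereads-∪ : ∀ U W V t → (∀ a → U a ≡ W a ∨ V a) →
    rereads U t ≡ rereads V t + length (transfer W V t)
  rereads-∪ U W V []           eq = refl
  rereads-∪ U W V (rd a v ∷ t) eq rewrite eq a with W a | V a
  ... | true  | true  = cong suc (rereads-∪ U W V t eq)
  ... | true  | false = trans (cong suc (rereads-∪ U W V t eq)) (sym (+-suc (rereads V t) _))
  ... | false | true  = cong suc (rereads-∪ U W V t eq)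
  ... | false | false = rereads-∪ U W V t eq
  rereads-∪ U W V (wr a v ∷ t) eq = rereads-∪ _ W (insert a V) t eq′
    where
    eq′ : ∀ b → insert a U b ≡ W b ∨ insert a V b
    eq′ b with does (a ≟ᶠ b)
    ... | true  = sym (∨-zeroʳ (W b))
    ... | false = eq b

  final-unwritten : ∀ p m V b → written V (probes p m) b ≡ false → final p m b ≡ m b × V b ≡ false
  final-unwritten (read a k)    m V b un = final-unwritten (k (m a)) m V b un
  final-unwritten (write a v p) m V b un with final-unwritten p (updateMem m a v) (insert a V) b un
  ... | same , un′ with does (a ≟ᶠ b)
  ...   | false = same , un′
  final-unwritten (out o)       m V b un = refl , un

  -- The memory of the decoder. A cell read several times is listed several times; the order of the
  -- entries is immaterial where they all hold the values of one memory.
  patch : Mem w → Cells → Mem w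
  patch m []            = m
  patch m ((a , v) ∷ P) = updateMem (patch m P) a v

  patch-base : ∀ {m μ : Mem w} {P : Cells} → All (λ (a , v) → v ≡ μ a) P →
    ∀ b → m b ≡ μ b → patch m P b ≡ μ b
  patch-base [] b eq = eq
  patch-base {P = (a , v) ∷ P} (v≡ ∷ vs) b eq with a ≟ᶠ b
  ... | yes refl = v≡
  ... | no _     = patch-base vs b eq

  patch-entry : ∀ {m μ : Mem w} {P : Cells} → All (λ (a , v) → v ≡ μ a) P →
    All (λ (a , _) → patch m P a ≡ μ a) P
  patch-entry [] = []
  patch-entry {m} {μ} {P = (a , v) ∷ P} (v≡ ∷ vs) = head ∷ All.map (λ {(b , _)} → over b) (patch-entry vs)
    where
    head : updateMem (patch m P) a v a ≡ μ a
    head with a ≟ᶠ a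
    ... | yes _  = v≡
    ... | no a≢a with () ← a≢a refl
    over : ∀ b → patch m P b ≡ μ b → updateMem (patch m P) a v b ≡ μ b
    over b eq with a ≟ᶠ b
    ... | yes refl = v≡
    ... | no _     = eq

  -- ν can stand in for μ: it may only be wrong on cells of W not yet
  -- overwritten, and T lists correctly those of them that will be read.
  record Simulates (W V : AddrSet) (μ ν : Mem w) (T : Cells) : Set where
    constructor sim
    field
      agree  : ∀ a → V a ≡ true ⊎ W a ≡ false → ν a ≡ μ a
      listed : All (λ (a , v) → V a ≡ false → ν a ≡ v) T

  -- A read outside `W`, or of an overwritten cell, sees equal memories; any other read consumes the
  -- head of the list, which supplies its value. A write makes the entries at its address vacuous,
  -- thanks to the guard in `listed`.
  simulate : ∀ W p μ ν V t → Simulates W V μ ν (transfer W V (probes p μ ++ t)) →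
    answer p ν ≡ answer p μ ×
    Simulates W (written V (probes p μ)) (final p μ) (final p ν) (transfer W (written V (probes p μ)) t)
  simulate W (read a k) μ ν V t (sim ag li) with W a in Wa | V a in Va
  ... | false | _    rewrite ag a (inj₂ Wa) = simulate W (k (μ a)) μ ν V t (sim ag li)
  ... | true  | true rewrite ag a (inj₁ Va) = simulate W (k (μ a)) μ ν V t (sim ag li)
  simulate W (read a k) μ ν V t (sim ag (here ∷ li)) | true | false
    rewrite here Va = simulate W (k (μ a)) μ ν V t (sim ag li)
  simulate W (write a v p) μ ν V t (sim ag li) =
    simulate W p (updateMem μ a v) (updateMem ν a v) (insert a V) t (sim ag′ (All.map (λ {(b , u)} → li′ b u) li))
    where
    ag′ : ∀ b → insert a V b ≡ true ⊎ W b ≡ false → updateMem ν a v b ≡ updateMem μ a v b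
    ag′ b h with does (a ≟ᶠ b)
    ... | true  = refl
    ... | false = ag b h
    li′ : ∀ b u → (V b ≡ false → ν b ≡ u) → insert a V b ≡ false → updateMem ν a v b ≡ u
    li′ b u h with does (a ≟ᶠ b)
    ... | false = h
    ... | true  = λ ()
  simulate W (out o) μ ν V t s = refl , s

  -- A cell not yet overwritten still holds its value from the start of the period, so all listed
  -- values belong to the one memory `m`.
  transfer-values : ∀ W p μ V (m : Mem w) → (∀ a → V a ≡ false → μ a ≡ m a) →
    All (λ (a , v) → v ≡ m a) (transfer W V (probes p μ)) ×
    (∀ a → written V (probes p μ) a ≡ false → final p μ a ≡ m a)
  transfer-values W (read a k) μ V m eq with W a | V a in Va
  ... | false | _     = transfer-values W (k (μ a)) μ V m eq
  ... | true  | true  = transfer-values W (k (μ a)) μ V m eq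
  ... | true  | false with transfer-values W (k (μ a)) μ V m eq
  ...   | vs , rest = eq a Va ∷ vs , rest
  transfer-values W (write a v p) μ V m eq = transfer-values W p (updateMem μ a v) (insert a V) m eq′
    where
    eq′ : ∀ b → insert a V b ≡ false → updateMem μ a v b ≡ m b
    eq′ b with does (a ≟ᶠ b)
    ... | false = eq b
    ... | true  = λ ()
  transfer-values W (out o) μ V m eq = [] , eq

  -- Injective codes for lists of cells

  wordCode : ∀ {n} → Vec Bool n → Fin (2 ^ n)
  wordCode []          = Fin.zero
  wordCode {suc n} (b ∷ v) = combine {2} (if b then Fin.suc Fin.zero else Fin.zero) (wordCode v)

  wordCode-injective : ∀ {n} (u v : Vec Bool n) → wordCode u ≡ wordCode v → u ≡ v
  wordCode-injective []      []      _  = refl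
  wordCode-injective {suc n} (b ∷ u) (c ∷ v) eq
    with combine-injective {2} (if b then Fin.suc Fin.zero else Fin.zero) (wordCode u) (if c then Fin.suc Fin.zero else Fin.zero) (wordCode v) eq
  ... | b≡c , u≡v = cong₂ _∷_ (bit b c b≡c) (wordCode-injective u v u≡v)
    where
    bit : ∀ b c → (if b then Fin.suc Fin.zero else Fin.zero) ≡ (if c then Fin.suc (Fin.zero {0}) else Fin.zero) → b ≡ c
    bit true  true  _ = refl
    bit false false _ = refl

  cellCode : Addr w × Word w → Fin (2 ^ w * 2 ^ w)
  cellCode (a , v) = combine a (wordCode v)

  cellCode-injective : ∀ {c d} → cellCode c ≡ cellCode d → c ≡ d
  cellCode-injective {a , u} {b , v} eq with combine-injective a (wordCode u) b (wordCode v) eq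
  ... | a≡b , u≡v = cong₂ _,_ a≡b (wordCode-injective u v u≡v)

-- The successor sets the empty list apart from all others, so lists of any length are numbered
-- injectively and no length has to be stored.
number : ∀ {β} → List (Fin β) → ℕ
number     []      = 0
number {β} (x ∷ l) = suc (toℕ x + β * number l)

number-injective : ∀ {β} (l k : List (Fin β)) → number l ≡ number k → l ≡ k
number-injective []      []      _  = refl
number-injective {β} (x ∷ l) (y ∷ k) eq with digits β (toℕ<n x) (toℕ<n y) (suc-injective eq)
... | x≡y , l≡k = cong₂ _∷_ (toℕ-injective x≡y) (number-injective l k l≡k)

number< : ∀ {β} (l : List (Fin β)) → number l < suc β ^ length l
number<     []      = s≤s z≤n
number< {β} (x ∷ l) = begin
  suc (suc (toℕ x + β * number l)) ≤⟨ s≤s (+-monoˡ-≤ (β * number l) (toℕ<n x)) ⟩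
  suc (β + β * number l)           ≡⟨ cong suc (sym (*-suc β (number l))) ⟩
  suc (β * suc (number l))         ≤⟨ +-monoˡ-≤ (β * suc (number l)) (s≤s (z≤n {number l})) ⟩
  suc β * suc (number l)           ≤⟨ *-monoʳ-≤ (suc β) (number< l) ⟩
  suc β * suc β ^ length l         ∎
  where open ≤-Reasoning

module _ {w : ℕ} where

  cellsCode : Cells {w} → ℕ
  cellsCode P = number (map cellCode P)

  cellsCode-injective : ∀ {P Q} → cellsCode P ≡ cellsCode Q → P ≡ Q
  cellsCode-injective eq = map-injective cellCode-injective (number-injective _ _ eq)

  -- Address and word take `2 * w` bits; the third `w` absorbs the step from base `β` to `suc β`,
  -- which is where `0 < w` enters.
  cellsCode< : 0 < w → ∀ P → cellsCode P < 2 ^ (3 * w * length P)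
  cellsCode< w>0 P = begin-strict
    cellsCode P                        <⟨ number< (map cellCode P) ⟩
    suc β ^ length (map cellCode P)    ≡⟨ cong (suc β ^_) (length-map cellCode P) ⟩
    suc β ^ length P                   ≤⟨ ^-monoˡ-≤ (length P) β<2³ʷ ⟩
    (2 ^ (3 * w)) ^ length P           ≡⟨ ^-*-assoc 2 (3 * w) (length P) ⟩
    2 ^ (3 * w * length P)             ∎
    where
    open ≤-Reasoning
    β = 2 ^ w * 2 ^ w
    three : ∀ w → w + w + w ≡ 3 * w
    three = solve-∀
    β<2³ʷ : β < 2 ^ (3 * w)
    β<2³ʷ = begin-strict
      β              ≡⟨ ^-distribˡ-+-* 2 w w ⟨
      2 ^ (w + w)    <⟨ ^-monoʳ-< 2 (s≤s (s≤s z≤n)) (m<m+n (w + w) w>0) ⟩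
      2 ^ (w + w + w) ≡⟨ cong (2 ^_) (three w) ⟩
      2 ^ (3 * w)    ∎

-- Traces of whole sequences of operations

module _ {δ w : ℕ} (A : Algorithm δ w) where

  private
    Str = List (Sym δ)

  state : Mem w → Str → Mem w
  state m []       = m
  state m (x ∷ xs) = state (final (arrive A x) m) xs

  answers : Mem w → Str → List ℕ
  answers m []       = []
  answers m (x ∷ xs) = answer (arrive A x) m ∷ answers (final (arrive A x) m) xs

  trace : Mem w → Str → List Event
  trace m []       = []
  trace m (x ∷ xs) = probes (arrive A x) m ++ trace (final (arrive A x) m) xs

  runFrom-spec : ∀ m xs → runFrom A m xs ≡ (answers m xs , length (trace m xs))
  runFrom-spec m []       = refl
  runFrom-spec m (x ∷ xs)
    rewrite exec-spec (arrive A x) m | runFrom-spec (final (arrive A x) m) xs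
          | length-++ (probes (arrive A x) m) {trace (final (arrive A x) m) xs} = refl

  outputs-spec : ∀ xs → outputs A xs ≡ answers (initMem A) xs
  outputs-spec xs rewrite runFrom-spec (initMem A) xs = refl

  cost-spec : ∀ xs → cost A xs ≡ length (trace (initMem A) xs)
  cost-spec xs rewrite runFrom-spec (initMem A) xs = refl

  trace-++ : ∀ m xs ys → trace m (xs ++ ys) ≡ trace m xs ++ trace (state m xs) ys
  trace-++ m []       ys = refl
  trace-++ m (x ∷ xs) ys =
    trans (cong (probes (arrive A x) m ++_) (trace-++ _ xs ys))
          (sym (++-assoc (probes (arrive A x) m) _ _))

  private
    state-unwritten : ∀ m V xs b → written V (trace m xs) b ≡ false → state m xs b ≡ m b × V b ≡ false
    state-unwritten m V []       b un = refl , un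
    state-unwritten m V (x ∷ xs) b un
      rewrite written-++ V (probes (arrive A x) m) (trace (final (arrive A x) m) xs)
      with state-unwritten (final (arrive A x) m) _ xs b un
    ... | same , un′ with final-unwritten (arrive A x) m V b un′
    ...   | same′ , un″ = trans same same′ , un″

    simulateAll : ∀ W xs μ ν V → Simulates W V μ ν (transfer W V (trace μ xs)) → answers ν xs ≡ answers μ xs
    simulateAll W []       μ ν V s = refl
    simulateAll W (x ∷ xs) μ ν V s with simulate W (arrive A x) μ ν V (trace (final (arrive A x) μ) xs) s
    ... | eq , s′ = cong₂ _∷_ eq (simulateAll W xs _ _ _ s′)

    transfer-valuesAll : ∀ W xs μ V (m : Mem w) → (∀ a → V a ≡ false → μ a ≡ m a) →
      All (λ (a , v) → v ≡ m a) (transfer W V (trace μ xs))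
    transfer-valuesAll W []       μ V m eq = []
    transfer-valuesAll W (x ∷ xs) μ V m eq
      rewrite transfer-++ W V (probes (arrive A x) μ) (trace (final (arrive A x) μ) xs)
      with transfer-values W (arrive A x) μ V m eq
    ... | vs , eq′ = ++⁺ vs (transfer-valuesAll W xs _ _ m eq′)

  IT : Mem w → Str → Str → Cells
  IT m xs ys = transfer (written (∅ {w}) (trace m xs)) (∅ {w}) (trace (state m xs) ys)

  private
    answers-patch : ∀ m xs ys → answers (patch m (IT m xs ys)) ys ≡ answers (state m xs) ys
    answers-patch m xs ys = simulateAll W ys (state m xs) _ (∅ {w}) (sim base (All.zipWith step (vals , patch-entry vals)))
      where
      W = written (∅ {w}) (trace m xs)
      vals = transfer-valuesAll W ys (state m xs) (∅ {w}) (state m xs) (λ _ _ → refl)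
      base : ∀ a → (∅ {w}) a ≡ true ⊎ W a ≡ false → patch m (IT m xs ys) a ≡ state m xs a
      base a (inj₂ un) = patch-base vals a (sym (proj₁ (state-unwritten m (∅ {w}) xs a un)))
      step : ∀ {c : Addr w × Word w} → (proj₂ c ≡ state m xs (proj₁ c)) × (patch m (IT m xs ys) (proj₁ c) ≡ state m xs (proj₁ c)) →
        false ≡ false → patch m (IT m xs ys) (proj₁ c) ≡ proj₂ c
      step (v≡ , p≡) _ = trans p≡ (sym v≡)

  -- Decoding starts from `m`, the memory before the left half, so it uses nothing of `xs` or `xs′`
  -- besides the listed cells.
  IT-determines-answers : ∀ m xs xs′ ys → IT m xs ys ≡ IT m xs′ ys →
    answers (state m xs) ys ≡ answers (state m xs′) ys
  IT-determines-answers m xs xs′ ys eq = begin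
    answers (state m xs) ys              ≡⟨ answers-patch m xs ys ⟨
    answers (patch m (IT m xs ys)) ys    ≡⟨ cong (λ P → answers (patch m P) ys) eq ⟩
    answers (patch m (IT m xs′ ys)) ys   ≡⟨ answers-patch m xs′ ys ⟩
    answers (state m xs′) ys             ∎
    where open ≡-Reasoning

  -- Probes that read a cell last written within the same period: those within
  -- xs, those within ys and those across are disjoint.
  localCost : Mem w → Str → ℕ
  localCost m xs = rereads (∅ {w}) (trace m xs)

  localCost-++ : ∀ m xs ys →
    localCost m (xs ++ ys) ≡ localCost m xs + (localCost (state m xs) ys + length (IT m xs ys))
  localCost-++ m xs ys = begin
    rereads (∅ {w}) (trace m (xs ++ ys))                            ≡⟨ cong (rereads (∅ {w})) (trace-++ m xs ys) ⟩
    rereads (∅ {w}) (trace m xs ++ trace (state m xs) ys)           ≡⟨ rereads-++ (∅ {w}) (trace m xs) _ ⟩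
    localCost m xs + rereads (written (∅ {w}) (trace m xs)) (trace (state m xs) ys)
      ≡⟨ cong (localCost m xs +_) (rereads-∪ (written (∅ {w}) (trace m xs)) (written (∅ {w}) (trace m xs)) (∅ {w}) (trace (state m xs) ys) (λ a → sym (∨-identityʳ (written (∅ {w}) (trace m xs) a)))) ⟩
    localCost m xs + (localCost (state m xs) ys + length (IT m xs ys)) ∎
    where open ≡-Reasoning

  localCost≤cost : ∀ xs ys → localCost (initMem A) xs ≤ cost A (xs ++ ys)
  localCost≤cost xs ys = begin
    localCost (initMem A) xs                                          ≤⟨ rereads≤length (∅ {w}) (trace (initMem A) xs) ⟩
    length (trace (initMem A) xs)                                     ≤⟨ m≤m+n _ _ ⟩
    length (trace (initMem A) xs) + length (trace (state (initMem A) xs) ys) ≡⟨ length-++ (trace (initMem A) xs) ⟨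
    length (trace (initMem A) xs ++ trace (state (initMem A) xs) ys)  ≡⟨ cong length (trace-++ (initMem A) xs ys) ⟨
    length (trace (initMem A) (xs ++ ys))                             ≡⟨ cost-spec (xs ++ ys) ⟨
    cost A (xs ++ ys)                                                 ∎
    where open ≤-Reasoning

-- Hamming distances along a stream

splitList : ∀ {A : Set} (zs : List A) t → t < length zs →
  ∃ λ xs → ∃ λ x → ∃ λ ys → zs ≡ xs ++ x ∷ ys × length xs ≡ t
splitList (z ∷ zs) zero    _       = [] , z , zs , refl , refl
splitList (z ∷ zs) (suc t) (s≤s h) with splitList zs t h
... | xs , x , ys , refl , refl = z ∷ xs , x , ys , refl , refl

module _ {A : Set} where

  -- Index 0 of a history is the most recent symbol.
  cons : A → (ℕ → A) → (ℕ → A)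
  cons x R zero    = x
  cons x R (suc d) = R d

  pushes : (ℕ → A) → List A → (ℕ → A)
  pushes R []       = R
  pushes R (x ∷ xs) = pushes (cons x R) xs

  pushes-++ : ∀ R xs ys → pushes R (xs ++ ys) ≡ pushes (pushes R xs) ys
  pushes-++ R []       ys = refl
  pushes-++ R (x ∷ xs) ys = pushes-++ (cons x R) xs ys

  window : ∀ n → (ℕ → A) → Vec A n
  window zero    R = []
  window (suc n) R = R n ∷ window n R

  shift-window : ∀ n R x → shift (window n R) x ≡ window n (cons x R)
  shift-window zero    R x = refl
  shift-window (suc n) R x = snoc n
    where
    snoc : ∀ n → window n R ∷ʳ x ≡ window (suc n) (cons x R)
    snoc zero    = refl
    snoc (suc n) = cong (R n ∷_) (snoc n)

neq : ∀ {N} → Fin N → Fin N → ℕ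
neq f s = if does (f ≟ᶠ s) then 0 else 1

module _ {N : ℕ} (G : ℕ → Fin N) where

  -- `G d` is the fixed symbol at distance `d` from the right end. One infinite `G` thus serves all
  -- lengths, and an arrival moves every older symbol one index up.
  dist : ℕ → ℕ → (ℕ → Fin N) → ℕ
  dist o zero    R = 0
  dist o (suc n) R = neq (G (o + n)) (R n) + dist o n R

  dist-cons : ∀ o n x R → dist o (suc n) (cons x R) ≡ neq (G o) x + dist (suc o) n R
  dist-cons o zero    x R = cong (λ d → neq (G d) x + 0) (+-identityʳ o)
  dist-cons o (suc n) x R = begin
    neq (G (o + suc n)) (R n) + dist o (suc n) (cons x R)      ≡⟨ cong₂ (λ d e → neq (G d) (R n) + e) (+-suc o n) (dist-cons o n x R) ⟩
    neq (G (suc o + n)) (R n) + (neq (G o) x + dist (suc o) n R) ≡⟨ +-assoc-comm′ (neq (G (suc o + n)) (R n)) (neq (G o) x) _ ⟩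
    neq (G o) x + (neq (G (suc o + n)) (R n) + dist (suc o) n R) ∎
    where
    open ≡-Reasoning
    +-assoc-comm′ : ∀ a b c → a + (b + c) ≡ b + (a + c)
    +-assoc-comm′ a b c = trans (sym (+-assoc a b c)) (trans (cong (_+ c) (+-comm a b)) (+-assoc b a c))

  -- The mismatches of xs when p further symbols have arrived after it.
  mismatches : ℕ → List (Fin N) → ℕ
  mismatches p []       = 0
  mismatches p (x ∷ xs) = neq (G (p + length xs)) x + mismatches p xs

  mismatches-++ : ∀ p xs ys → mismatches p (xs ++ ys) ≡ mismatches (p + length ys) xs + mismatches p ys
  mismatches-++ p []       ys = refl
  mismatches-++ p (x ∷ xs) ys = begin
    neq (G (p + length (xs ++ ys))) x + mismatches p (xs ++ ys)
      ≡⟨ cong₂ (λ d e → neq (G d) x + e) offset (mismatches-++ p xs ys) ⟩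
    neq (G (p + length ys + length xs)) x + (mismatches (p + length ys) xs + mismatches p ys)
      ≡⟨ +-assoc (neq (G (p + length ys + length xs)) x) _ _ ⟨
    neq (G (p + length ys + length xs)) x + mismatches (p + length ys) xs + mismatches p ys ∎
    where
    open ≡-Reasoning
    offset : p + length (xs ++ ys) ≡ p + length ys + length xs
    offset = trans (cong (p +_) (trans (length-++ xs) (+-comm (length xs) (length ys)))) (sym (+-assoc p _ _))

  dist-pushes : ∀ xs n R → dist 0 (length xs + n) (pushes R xs) ≡ mismatches 0 xs + dist (length xs) n R
  dist-pushes []       n R = refl
  dist-pushes (x ∷ xs) n R = begin
    dist 0 (suc (length xs + n)) (pushes (cons x R) xs)     ≡⟨ cong (λ L → dist 0 L (pushes (cons x R) xs)) (+-suc (length xs) n) ⟨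
    dist 0 (length xs + suc n) (pushes (cons x R) xs)       ≡⟨ dist-pushes xs (suc n) (cons x R) ⟩
    mismatches 0 xs + dist (length xs) (suc n) (cons x R)   ≡⟨ cong (mismatches 0 xs +_) (dist-cons (length xs) n x R) ⟩
    mismatches 0 xs + (neq (G (length xs)) x + d)           ≡⟨ +-assoc (mismatches 0 xs) _ _ ⟨
    mismatches 0 xs + neq (G (length xs)) x + d             ≡⟨ cong (_+ d) (+-comm (mismatches 0 xs) _) ⟩
    neq (G (length xs)) x + mismatches 0 xs + d             ∎
    where
    open ≡-Reasoning
    d = dist (suc (length xs)) n R

  dists : ℕ → (ℕ → Fin N) → List (Fin N) → List ℕ
  dists n R []       = []
  dists n R (x ∷ xs) = dist 0 n (cons x R) ∷ dists n (cons x R) xs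

  dists-at : ∀ n R R′ xs x ys → dists n R (xs ++ x ∷ ys) ≡ dists n R′ (xs ++ x ∷ ys) →
    dist 0 n (pushes R (xs ++ x ∷ [])) ≡ dist 0 n (pushes R′ (xs ++ x ∷ []))
  dists-at n R R′ []       x ys eq = ∷-injectiveˡ eq
  dists-at n R R′ (z ∷ xs) x ys eq = dists-at n (cons z R) (cons z R′) xs x ys (∷-injectiveʳ eq)

  -- Everything outside u cancels.
  dists-isolate : ∀ n R pre u u′ post zs t → length u ≡ length u′ → t < length zs →
    length u + (length post + suc t) ≤ n →
    dists n (pushes R (pre ++ u ++ post)) zs ≡ dists n (pushes R (pre ++ u′ ++ post)) zs →
    mismatches (length post + suc t) u ≡ mismatches (length post + suc t) u′
  dists-isolate n R pre u u′ post zs t |u| t< fits eq with splitList zs t t<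
  ... | xs , x , ys , refl , refl = +-cancelʳ-≡ rest _ _ (begin
    mismatches p u + rest                      ≡⟨ total u refl ⟨
    dist 0 n (pushes (pushes R (pre ++ u ++ post)) r)    ≡⟨ dists-at n _ _ xs x ys eq ⟩
    dist 0 n (pushes (pushes R (pre ++ u′ ++ post)) r)   ≡⟨ total u′ (sym |u|) ⟩
    mismatches p u′ + rest                     ∎)
    where
    open ≡-Reasoning
    open import Data.Nat using (_∸_)
    r = xs ++ x ∷ []
    p = length post + suc (length xs)
    gap = n ∸ (length u + p)
    tail = mismatches 0 (post ++ r)
    rest = tail + dist (length u + p) gap (pushes R pre)
    |post++r| : length (post ++ r) ≡ p
    |post++r| = trans (length-++ post) (cong (length post +_) (trans (length-++ xs) (+-comm (length xs) 1)))
    regroup : ∀ v → pushes (pushes R (pre ++ v ++ post)) r ≡ pushes (pushes R pre) (v ++ post ++ r)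
    regroup v = trans (sym (pushes-++ R (pre ++ v ++ post) r))
      (trans (cong (pushes R) (trans (++-assoc pre (v ++ post) r) (cong (pre ++_) (++-assoc v post r))))
             (pushes-++ R pre (v ++ post ++ r)))
    total : ∀ v → length v ≡ length u → dist 0 n (pushes (pushes R (pre ++ v ++ post)) r) ≡ mismatches p v + rest
    total v |v| = begin
      dist 0 n (pushes (pushes R (pre ++ v ++ post)) r)
        ≡⟨ cong (dist 0 n) (regroup v) ⟩
      dist 0 n (pushes (pushes R pre) (v ++ post ++ r))
        ≡⟨ cong (λ L → dist 0 L (pushes (pushes R pre) (v ++ post ++ r))) (trans (cong (_+ gap) |vpr|) (m+[n∸m]≡n fits)) ⟨
      dist 0 (length (v ++ post ++ r) + gap) (pushes (pushes R pre) (v ++ post ++ r))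
        ≡⟨ dist-pushes (v ++ post ++ r) gap (pushes R pre) ⟩
      mismatches 0 (v ++ post ++ r) + dist (length (v ++ post ++ r)) gap (pushes R pre)
        ≡⟨ cong₂ (λ M L → M + dist L gap (pushes R pre)) (mismatches-++ 0 v (post ++ r)) |vpr| ⟩
      mismatches (length (post ++ r)) v + tail + dist (length u + p) gap (pushes R pre)
        ≡⟨ cong (λ q → mismatches q v + tail + dist (length u + p) gap (pushes R pre)) |post++r| ⟩
      mismatches p v + tail + dist (length u + p) gap (pushes R pre)
        ≡⟨ +-assoc (mismatches p v) tail _ ⟩
      mismatches p v + rest ∎
      where
      |vpr| : length (v ++ post ++ r) ≡ length u + p
      |vpr| = trans (length-++ v) (cong₂ _+_ |v| |post++r|)

module _ (δ : ℕ) (G : ℕ → Sym δ) where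

  hamming-window : ∀ n R → hamming δ (window n G) (window n R) ≡ dist G 0 n R
  hamming-window zero    R = refl
  hamming-window (suc n) R = cong (neq (G n) (R n) +_) (hamming-window n R)

  hammingOutputs-window : ∀ n R xs → hammingOutputs δ (window n G) (window n R) xs ≡ dists G n R xs
  hammingOutputs-window n R []       = refl
  hammingOutputs-window n R (x ∷ xs) rewrite shift-window n R x =
    cong₂ _∷_ (hamming-window n (cons x R)) (hammingOutputs-window n (cons x R) xs)

-- Block schemes

Σ< : ℕ → (ℕ → ℕ) → ℕ
Σ< zero    f = 0
Σ< (suc n) f = f n + Σ< n f

2^>0 : ∀ a → 0 < 2 ^ a
2^>0 a = m^n>0 2 a

2^suc : ∀ a → 2 ^ suc a ≡ 2 ^ a + 2 ^ a
2^suc a = cong (2 ^ a +_) (+-identityʳ (2 ^ a))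

-- Strictly between `3 * 2 ^ a` and `5 * 2 ^ a` the only power of two is `4 * 2 ^ a`. While the
-- third quarter is tested its blocks stay in this interval, so the patterns of other levels do not
-- interfere.
only-power : ∀ a b x → 0 < x → x < 2 * 2 ^ a → 3 * 2 ^ a + x ≡ 2 ^ b → x ≡ 2 ^ a
only-power a b x x>0 x< eq with <-cmp b (2 + a)
... | tri≈ _ refl _ = +-cancelˡ-≡ (3 * 2 ^ a) _ _ (trans eq (four (2 ^ a)))
  where
  four : ∀ q → 2 * (2 * q) ≡ 3 * q + q
  four = solve-∀
... | tri< b< _ _ = contradiction eq (>⇒≢ (begin-strict
  2 ^ b           ≤⟨ ^-monoʳ-≤ 2 (≤-pred b<) ⟩
  2 * 2 ^ a       ≤⟨ *-monoˡ-≤ (2 ^ a) (s≤s (s≤s (z≤n {1}))) ⟩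
  3 * 2 ^ a       <⟨ m<m+n (3 * 2 ^ a) x>0 ⟩
  3 * 2 ^ a + x   ∎))
  where open ≤-Reasoning
... | tri> _ _ b> = contradiction eq (<⇒≢ (begin-strict
  3 * 2 ^ a + x           <⟨ +-monoʳ-< (3 * 2 ^ a) x< ⟩
  3 * 2 ^ a + 2 * 2 ^ a   ≤⟨ m≤m+n _ (3 * 2 ^ a) ⟩
  3 * 2 ^ a + 2 * 2 ^ a + 3 * 2 ^ a ≡⟨ eight (2 ^ a) ⟩
  2 ^ (3 + a)             ≤⟨ ^-monoʳ-≤ 2 b> ⟩
  2 ^ b                   ∎))
  where
  open ≤-Reasoning
  eight : ∀ q → 3 * q + 2 * q + 3 * q ≡ 2 * (2 * (2 * q))
  eight = solve-∀

-- Fin (card Q a) stands for the vectors of 2 ^ a digits below Q.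
card : ℕ → ℕ → ℕ
card Q zero    = Q
card Q (suc a) = card Q a * card Q a

card-2^ : ∀ e a → card (2 ^ e) a ≡ 2 ^ (e * 2 ^ a)
card-2^ e zero    = cong (2 ^_) (sym (*-identityʳ e))
card-2^ e (suc a) = begin
  card (2 ^ e) a * card (2 ^ e) a       ≡⟨ cong₂ _*_ (card-2^ e a) (card-2^ e a) ⟩
  2 ^ (e * 2 ^ a) * 2 ^ (e * 2 ^ a)     ≡⟨ ^-distribˡ-+-* 2 (e * 2 ^ a) _ ⟨
  2 ^ (e * 2 ^ a + e * 2 ^ a)           ≡⟨ cong (2 ^_) (trans (sym (*-distribˡ-+ e (2 ^ a) _)) (cong (e *_) (sym (2^suc a)))) ⟩
  2 ^ (e * 2 ^ suc a)                   ∎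
  where open ≡-Reasoning

halves : ∀ {N} → Fin (N * N) → Fin N × Fin N
halves {N} = remQuot {N} N

halves-injective : ∀ {N} (i j : Fin (N * N)) →
  proj₁ (halves {N} i) ≡ proj₁ (halves {N} j) → proj₂ (halves {N} i) ≡ proj₂ (halves {N} j) → i ≡ j
halves-injective {N} i j eq₁ eq₂ =
  trans (sym (combine-remQuot {N} N i)) (trans (cong₂ combine eq₁ eq₂) (combine-remQuot {N} N j))

listBelow : ∀ {A : Set} → ℕ → (ℕ → A) → List A
listBelow zero    f = []
listBelow (suc n) f = f n ∷ listBelow n f

length-listBelow : ∀ {A : Set} n (f : ℕ → A) → length (listBelow n f) ≡ n
length-listBelow zero    f = refl
length-listBelow (suc n) f = cong suc (length-listBelow n f)

-- Blocks of 2 ^ k symbols carry e bits each. Test i reads a block that is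
-- 2 ^ b + 2 i block lengths away, up to the shift i, which makes the residues
-- of the test distances modulo the block length distinct: at any time a single
-- test is aligned, and the other blocks are then silent.
record Scheme (δ : ℕ) : Set where
  field
    k e tests : ℕ
    G         : ℕ → Sym δ
    code      : Fin (2 ^ e) → ℕ → Sym δ

  m : ℕ
  m = 2 ^ k

  blockDist : ℕ → Fin (2 ^ e) → ℕ
  blockDist s c = Σ< m (λ r → neq (G (s + r)) (code c r))

  Silent : ℕ → Set
  Silent s = ∀ c c′ → blockDist s c ≡ blockDist s c′

  testDist : ℕ → ℕ → ℕ
  testDist b i = i + (2 ^ b + 2 * i) * m

  field
    tests≤ : tests ≤ m
    silent : ∀ i z → i < tests → (∀ b → z ≢ 2 ^ b + 2 * i) → Silent (i + z * m)
    detect : ∀ b → k < b → ∀ c c′ →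
      (∀ i → i < tests → blockDist (testDist b i) c ≡ blockDist (testDist b i) c′) → c ≡ c′

module _ {δ : ℕ} (S : Scheme δ) where

  open Scheme S

  Index : ℕ → Set
  Index a = Fin (card (2 ^ e) a)

  firstHalf secondHalf : ∀ a → Index (suc a) → Index a
  firstHalf  a i = proj₁ (halves {card (2 ^ e) a} i)
  secondHalf a i = proj₂ (halves {card (2 ^ e) a} i)

  word : ∀ a → Index a → List (Sym δ)
  word zero    c = listBelow m (code c)
  word (suc a) i = word a (firstHalf a i) ++ word a (secondHalf a i)

  length-word : ∀ a i → length (word a i) ≡ 2 ^ a * m
  length-word zero    c = trans (length-listBelow m (code c)) (sym (+-identityʳ m))
  length-word (suc a) i = begin
    length (word (suc a) i)             ≡⟨ length-++ (word a (firstHalf a i)) ⟩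
    length (word a (firstHalf a i)) + length (word a (secondHalf a i))
      ≡⟨ cong₂ _+_ (length-word a (firstHalf a i)) (length-word a (secondHalf a i)) ⟩
    2 ^ a * m + 2 ^ a * m               ≡⟨ *-distribʳ-+ m (2 ^ a) (2 ^ a) ⟨
    (2 ^ a + 2 ^ a) * m                 ≡⟨ cong (_* m) (2^suc a) ⟨
    2 ^ suc a * m                       ∎
    where open ≡-Reasoning

  word-combine : ∀ a i j → word (suc a) (combine {card (2 ^ e) a} i j) ≡ word a i ++ word a j
  word-combine a i j = cong₂ (λ x y → word a x ++ word a y)
    (cong proj₁ (remQuot-combine {card (2 ^ e) a} i j)) (cong proj₂ (remQuot-combine {card (2 ^ e) a} i j))

  private
    mm : ℕ → List (Sym δ) → ℕ
    mm = mismatches G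

    mm-block : ∀ p n f → mm p (listBelow n f) ≡ Σ< n (λ r → neq (G (p + r)) (f r))
    mm-block p zero    f = refl
    mm-block p (suc n) f = cong₂ (λ l s → neq (G (p + l)) (f n) + s) (length-listBelow n f) (mm-block p n f)

    mm-word : ∀ a p i → mm p (word (suc a) i) ≡
      mm (p + 2 ^ a * m) (word a (firstHalf a i)) + mm p (word a (secondHalf a i))
    mm-word a p i = trans (mismatches-++ G p (word a (firstHalf a i)) (word a (secondHalf a i)))
      (cong (λ l → mm (p + l) (word a (firstHalf a i)) + mm p (word a (secondHalf a i))) (length-word a (secondHalf a i)))

    later : ∀ p x j m → p + x * m + j * m ≡ p + (x + j) * m
    later = solve-∀

    low< : ∀ a {j} → j < 2 ^ a → j < 2 ^ suc a
    low< a j< = <-≤-trans j< (m≤m+n (2 ^ a) _)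

    high< : ∀ a {j} → j < 2 ^ a → 2 ^ a + j < 2 ^ suc a
    high< a j< = <-≤-trans (+-monoʳ-< (2 ^ a) j<) (≤-reflexive (sym (2^suc a)))

  mm-silent : ∀ a p i i′ → (∀ j → j < 2 ^ a → Silent (p + j * m)) → mm p (word a i) ≡ mm p (word a i′)
  mm-silent zero    p c c′ sil = begin
    mm p (listBelow m (code c))   ≡⟨ mm-block p m (code c) ⟩
    blockDist p c                 ≡⟨ subst Silent (+-identityʳ p) (sil 0 (s≤s z≤n)) c c′ ⟩
    blockDist p c′                ≡⟨ mm-block p m (code c′) ⟨
    mm p (listBelow m (code c′))  ∎
    where open ≡-Reasoning
  mm-silent (suc a) p i i′ sil = begin
    mm p (word (suc a) i)                               ≡⟨ mm-word a p i ⟩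
    mm (p + 2 ^ a * m) (word a (firstHalf a i)) + mm p (word a (secondHalf a i)) ≡⟨ cong₂ _+_
      (mm-silent a (p + 2 ^ a * m) (firstHalf a i) (firstHalf a i′) (λ j j< → subst Silent (sym (later p (2 ^ a) j m)) (sil (2 ^ a + j) (high< a j<))))
      (mm-silent a p (secondHalf a i) (secondHalf a i′) (λ j j< → sil j (low< a j<))) ⟩
    mm (p + 2 ^ a * m) (word a (firstHalf a i′)) + mm p (word a (secondHalf a i′)) ≡⟨ mm-word a p i′ ⟨
    mm p (word (suc a) i′)                              ∎
    where open ≡-Reasoning

  -- Blocks are numbered from the newest, and `p` symbols have arrived after the word. `agree`
  -- speaks of the whole word because only the total count is observable.
  record Test (b a : ℕ) (i i′ : Index a) (j t : ℕ) : Set where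
    constructor test
    field
      p       : ℕ
      aligned : p + j * m ≡ testDist b t
      others  : ∀ j′ → j′ < 2 ^ a → j′ ≢ j → Silent (p + j′ * m)
      agree   : mm p (word a i) ≡ mm p (word a i′)

  -- The half of the word without block `j` is silent and cancels from `agree`, so a test of the
  -- word is a test of one of its halves; at a single block `detect` takes over.
  decode : ∀ b → k < b → ∀ a i i′ →
    (∀ j → j < 2 ^ a → ∀ t → t < tests → Test b a i i′ j t) → i ≡ i′
  decode b k<b zero    c c′ ts = detect b k<b c c′ λ t t< → lemma t (ts 0 (s≤s z≤n) t t<)
    where
    open ≡-Reasoning
    lemma : ∀ t → Test b 0 c c′ 0 t → blockDist (testDist b t) c ≡ blockDist (testDist b t) c′
    lemma t (test p al _ ag) rewrite sym al | +-identityʳ p = begin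
      blockDist p c                 ≡⟨ mm-block p m (code c) ⟨
      mm p (listBelow m (code c))   ≡⟨ ag ⟩
      mm p (listBelow m (code c′))  ≡⟨ mm-block p m (code c′) ⟩
      blockDist p c′                ∎
  decode b k<b (suc a) i i′ ts = halves-injective {card (2 ^ e) a} i i′
    (decode b k<b a i₁ i₁′ older) (decode b k<b a i₂ i₂′ newer)
    where
    i₁ = firstHalf a i
    i₂ = secondHalf a i
    i₁′ = firstHalf a i′
    i₂′ = secondHalf a i′
    parts : ∀ p → mm p (word (suc a) i) ≡ mm p (word (suc a) i′) →
      mm (p + 2 ^ a * m) (word a i₁) + mm p (word a i₂) ≡ mm (p + 2 ^ a * m) (word a i₁′) + mm p (word a i₂′)
    parts p ag = trans (sym (mm-word a p i)) (trans ag (mm-word a p i′))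
    newer : ∀ j → j < 2 ^ a → ∀ t → t < tests → Test b a i₂ i₂′ j t
    newer j j< t t< with ts j (low< a j<) t t<
    ... | test p al ot ag = test p al (λ j′ j′< → ot j′ (low< a j′<))
      (+-cancelˡ-≡ (mm (p + 2 ^ a * m) (word a i₁)) _ _
        (trans (parts p ag) (cong (_+ mm p (word a i₂′)) (sym (mm-silent a (p + 2 ^ a * m) i₁ i₁′ λ j′ j′< →
          subst Silent (sym (later p (2 ^ a) j′ m))
            (ot (2 ^ a + j′) (high< a j′<) λ eq → <⇒≢ (<-≤-trans j< (m≤m+n (2 ^ a) j′)) (sym eq)))))))
    older : ∀ j → j < 2 ^ a → ∀ t → t < tests → Test b a i₁ i₁′ j t
    older j j< t t< with ts (2 ^ a + j) (high< a j<) t t<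
    ... | test p al ot ag = test (p + 2 ^ a * m) (trans (later p (2 ^ a) j m) al)
      (λ j′ j′< j′≢ → subst Silent (sym (later p (2 ^ a) j′ m))
        (ot (2 ^ a + j′) (high< a j′<) λ eq → j′≢ (+-cancelˡ-≡ (2 ^ a) _ _ eq)))
      (+-cancelʳ-≡ (mm p (word a i₂)) _ _
        (trans (parts p ag) (cong (mm (p + 2 ^ a * m) (word a i₁′) +_) (sym (mm-silent a p i₂ i₂′ λ j′ j′< →
          ot j′ (low< a j′<) λ eq → <⇒≢ (<-≤-trans j′< (m≤m+n (2 ^ a) j)) eq)))))

  -- When a block of the third quarter is aligned with a test of this level, no
  -- block of that quarter is aligned with any other test; the fourth quarter
  -- leaves room for the spread of the test distances.
  outputs-determine : ∀ n R a → k < a → 2 ^ (3 + a) * m ≤ n →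
    ∀ pre (i i′ q : Index a) zs → length zs ≡ 2 ^ (2 + a) * m →
    dists G n (pushes R (pre ++ word a i ++ word a q)) zs ≡
    dists G n (pushes R (pre ++ word a i′ ++ word a q)) zs → i ≡ i′
  outputs-determine n R a k<a fits pre i i′ q zs |zs| eq =
    decode (2 + a) (m≤n⇒m≤1+n (m≤n⇒m≤1+n k<a)) a i i′ tests′
    where
    Q = 2 ^ a
    2m≤Q : 2 * m ≤ Q
    2m≤Q = ^-monoʳ-≤ 2 k<a
    tests′ : ∀ j → j < 2 ^ a → ∀ t → t < tests → Test (2 + a) a i i′ j t
    tests′ j j< t t< = test p aligned others agree
      where
      d = Q ∸ j
      d>0 : 0 < d
      d>0 = m<n⇒0<n∸m j<
      d≤Q : d ≤ Q
      d≤Q = m∸n≤m Q j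
      d+j : d + j ≡ Q
      d+j = m∸n+n≡m (<⇒≤ j<)
      t<m : t < m
      t<m = <-≤-trans t< tests≤
      -- Chosen to put block `j` at the test distance of level `2 + a`, whose leading term is
      -- `4 * Q`; recall that `d + j` is `Q`.
      p = t + (3 * Q + d + 2 * t) * m
      split-p : ∀ t Q d m → t + (3 * Q + d + 2 * t) * m ≡ (Q * m + d * m) + (t + (2 * Q + 2 * t) * m)
      split-p = solve-∀
      p≡ : ∀ j d t m → t + (3 * (d + j) + d + 2 * t) * m + j * m ≡ t + (2 * (2 * (d + j)) + 2 * t) * m
      p≡ = solve-∀
      aligned : p + j * m ≡ testDist (2 + a) t
      aligned = subst (λ q → t + (3 * q + d + 2 * t) * m + j * m ≡ t + (2 * (2 * q) + 2 * t) * m) d+j (p≡ j d t m)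
      regroup : ∀ t Q d j m → t + (3 * Q + (d + j) + 2 * t) * m ≡ t + (3 * Q + d + 2 * t) * m + j * m
      regroup = solve-∀
      -- Block `j′` meets test `t` only if `3 * Q + d + j′` is a power of two, hence `4 * Q`, which
      -- leaves `j′ ≡ j` alone.
      others : ∀ j′ → j′ < 2 ^ a → j′ ≢ j → Silent (p + j′ * m)
      others j′ j′< j′≢j = subst Silent (regroup t Q d j′ m)
        (silent t (3 * Q + (d + j′) + 2 * t) t< λ b eq → j′≢j (+-cancelˡ-≡ d _ _
          (trans (only-power a b (d + j′) (≤-trans d>0 (m≤m+n d j′))
            (<-≤-trans (+-mono-≤-< d≤Q j′<) (≤-reflexive (sym (2^suc a))))
            (+-cancelʳ-≡ (2 * t) _ _ eq)) (sym d+j))))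
      open ≤-Reasoning
      low : Q * m < p
      low = begin-strict
        Q * m                 <⟨ m<m+n (Q * m) (*-mono-≤ d>0 (2^>0 k)) ⟩
        Q * m + d * m         ≤⟨ m≤m+n _ _ ⟩
        (Q * m + d * m) + (t + (2 * Q + 2 * t) * m) ≡⟨ split-p t Q d m ⟨
        p                     ∎
      five : ∀ Q m → 3 * (Q * m) + Q * m + Q * m ≡ Q * m + 2 * (2 * Q) * m
      five = solve-∀
      spread : ∀ t Q d m → t + (3 * Q + d + 2 * t) * m ≡ 3 * (Q * m) + d * m + (t + 2 * t * m)
      spread = solve-∀
      odd : ∀ t m → m + 2 * t * m + m ≡ 2 * (suc t) * m
      odd = solve-∀
      -- By `t < m` and `2 * m ≤ Q`, the spread of the test distances fits into one quarter; `k < a`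
      -- is used here.
      test≤ : t + 2 * t * m ≤ Q * m
      test≤ = begin
        t + 2 * t * m     ≤⟨ +-monoˡ-≤ (2 * t * m) (<⇒≤ t<m) ⟩
        m + 2 * t * m     ≤⟨ m≤m+n _ m ⟩
        m + 2 * t * m + m ≡⟨ odd t m ⟩
        2 * suc t * m     ≤⟨ *-monoˡ-≤ m (≤-trans (*-monoʳ-≤ 2 t<m) 2m≤Q) ⟩
        Q * m             ∎
      high : p ≤ Q * m + 2 ^ (2 + a) * m
      high = begin
        p                                    ≡⟨ spread t Q d m ⟩
        3 * (Q * m) + d * m + (t + 2 * t * m) ≤⟨ +-mono-≤ (+-monoʳ-≤ (3 * (Q * m)) (*-monoˡ-≤ m d≤Q)) test≤ ⟩
        3 * (Q * m) + Q * m + Q * m          ≡⟨ five Q m ⟩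
        Q * m + 2 ^ (2 + a) * m              ∎
      -- The third quarter is followed by the `Q * m` symbols of `q` and then by `suc s` symbols of
      -- `zs`; so `p` has to exceed `Q * m`.
      s = p ∸ suc (Q * m)
      p≡s : Q * m + suc s ≡ p
      p≡s = trans (+-suc (Q * m) s) (m+[n∸m]≡n low)
      s< : s < length zs
      s< = +-cancelˡ-≤ (Q * m) _ _ (begin
        Q * m + suc s                ≡⟨ p≡s ⟩
        p                            ≤⟨ high ⟩
        Q * m + 2 ^ (2 + a) * m      ≡⟨ cong (Q * m +_) |zs| ⟨
        Q * m + length zs            ∎)
      |q| = length-word a q
      six : ∀ Q m → Q * m + (Q * m + 2 * (2 * Q) * m) + (2 * Q * m) ≡ 2 * (2 * (2 * Q)) * m
      six = solve-∀
      inside : length (word a i) + (length (word a q) + suc s) ≤ n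
      inside = begin
        length (word a i) + (length (word a q) + suc s) ≡⟨ cong₂ (λ x y → x + (y + suc s)) (length-word a i) |q| ⟩
        Q * m + (Q * m + suc s)                   ≡⟨ cong (Q * m +_) p≡s ⟩
        Q * m + p                                 ≤⟨ +-monoʳ-≤ (Q * m) high ⟩
        Q * m + (Q * m + 2 ^ (2 + a) * m)         ≤⟨ m≤m+n _ (2 * Q * m) ⟩
        Q * m + (Q * m + 2 ^ (2 + a) * m) + 2 * Q * m ≡⟨ six Q m ⟩
        2 ^ (3 + a) * m                           ≤⟨ fits ⟩
        n                                         ∎
      agree : mm p (word a i) ≡ mm p (word a i′)
      agree = subst (λ x → mm x (word a i) ≡ mm x (word a i′)) (trans (cong (_+ suc s) |q|) p≡s)
        (dists-isolate G n R pre (word a i) (word a i′) (word a q) zs s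
          (trans (length-word a i) (sym (length-word a i′))) s< inside eq)

-- Information transfer over a binary tree of periods

module _ {δ w : ℕ} (S : Scheme δ) (A : Algorithm δ w) (w>0 : 0 < w) (n : ℕ) where

  open Scheme S

  private
    M : ℕ → ℕ
    M = card (2 ^ e)

  Correct : Mem w → (ℕ → Sym δ) → Set
  Correct μ R = ∀ xs → answers A μ xs ≡ dists G n R xs

  Correct-state : ∀ xs {μ R} → Correct μ R → Correct (state A μ xs) (pushes R xs)
  Correct-state []       ok = ok
  Correct-state (x ∷ xs) ok = Correct-state xs (λ ys → ∷-injectiveʳ (ok (x ∷ ys)))

  private
    |IT| : Mem w → List (Sym δ) → List (Sym δ) → ℕ
    |IT| μ xs ys = length (IT A μ xs ys)

  -- With everything but the third quarter fixed, the transferred cells encode `i` injectively, and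
  -- `code-length` bounds their average number. The 6 is its factor 2 times the 3 of `3 * w` bits
  -- per cell.
  third-quarter-transfer : ∀ a → k < a → 2 ^ (3 + a) * m ≤ n → ∀ {μ R} → Correct μ R →
    ∀ pre (q : Index S a) zs → length zs ≡ 2 ^ (2 + a) * m →
    M a * (e * 2 ^ a) ≤ 6 * w * sumFin (M a) (λ i → |IT| μ (pre ++ word S a i ++ word S a q) zs)
  third-quarter-transfer a k<a fits {μ} {R} ok pre q zs |zs| = ≤-trans
    (code-length (e * 2 ^ a) (card-2^ e a) (3 * w) len (λ i → cellsCode (cells i)) injective (λ i → cellsCode< w>0 (cells i)))
    (≤-reflexive (six w (sumFin (M a) len)))
    where
    left = λ i → pre ++ word S a i ++ word S a q
    cells = λ i → IT A μ (left i) zs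
    len = λ i → length (cells i)
    six : ∀ w s → 2 * (3 * w * s) ≡ 6 * w * s
    six = solve-∀
    injective : InjectiveCode (λ i → cellsCode (cells i))
    injective i j eq = outputs-determine S n R a k<a fits pre i j q zs |zs| (begin
      dists G n (pushes R (left i)) zs  ≡⟨ Correct-state (left i) ok zs ⟨
      answers A (state A μ (left i)) zs ≡⟨ IT-determines-answers A μ (left i) (left j) zs (cellsCode-injective {P = cells i} {Q = cells j} eq) ⟩
      answers A (state A μ (left j)) zs ≡⟨ Correct-state (left j) ok zs ⟩
      dists G n (pushes R (left j)) zs  ∎)
      where open ≡-Reasoning

  total-transfer : ∀ a → k < a → 2 ^ (3 + a) * m ≤ n → ∀ {μ R} → Correct μ R →
    M (2 + a) * (M (2 + a) * (e * 2 ^ a)) ≤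
    6 * w * sumFin (M (2 + a)) (λ i → sumFin (M (2 + a)) (λ j → |IT| μ (word S (2 + a) i) (word S (2 + a) j)))
  total-transfer a k<a fits {μ} ok = begin
    N * (N * E)    ≤⟨ sumFin-lower N (6 * w) (N * E) (λ j → sumFin N (λ i → f i j)) (λ j → fixed-right j) ⟩
    6 * w * sumFin N (λ j → sumFin N (λ i → f i j)) ≡⟨ cong (6 * w *_) (sumFin-swap N N f) ⟨
    6 * w * sumFin N (λ i → sumFin N (λ j → f i j)) ∎
    where
    open ≤-Reasoning
    E = e * 2 ^ a
    N = M (2 + a)
    f : Index S (2 + a) → Index S (2 + a) → ℕ
    f i j = |IT| μ (word S (2 + a) i) (word S (2 + a) j)
    assoc : ∀ h x E → h * (x * x) * E ≡ h * (x * (x * E))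
    assoc = solve-∀
    words : ∀ h z q → word S (2 + a) (combine {M (suc a)} h (combine {M a} z q)) ≡ word S (suc a) h ++ word S a z ++ word S a q
    words h z q = trans (word-combine S (suc a) h (combine {M a} z q)) (cong (word S (suc a) h ++_) (word-combine S a z q))
    fixed-right : ∀ j → N * E ≤ 6 * w * sumFin N (λ i → f i j)
    fixed-right j = begin
      N * E                             ≡⟨ assoc (M (suc a)) (M a) E ⟩
      M (suc a) * (M a * (M a * E))     ≤⟨ sumFin-lower (M (suc a)) (6 * w) _ _ (λ h → sumFin-lower (M a) (6 * w) _ _ (λ q →
        third-quarter-transfer a k<a fits ok (word S (suc a) h) q (word S (2 + a) j) (length-word S (2 + a) j))) ⟩
      6 * w * sumFin (M (suc a)) (λ h → sumFin (M a) (λ q → sumFin (M a) (λ z →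
        |IT| μ (word S (suc a) h ++ word S a z ++ word S a q) (word S (2 + a) j))))
        ≡⟨ cong (6 * w *_) (sumFin-cong (M (suc a)) (λ h → trans (sumFin-swap (M a) (M a) _)
             (sumFin-cong (M a) (λ z → sumFin-cong (M a) (λ q → cong (λ v → |IT| μ v (word S (2 + a) j)) (sym (words h z q))))))) ⟩
      6 * w * sumFin (M (suc a)) (λ h → sumFin (M a) (λ z → sumFin (M a) (λ q → f (combine {M (suc a)} h (combine {M a} z q)) j)))
        ≡⟨ cong (6 * w *_) (sumFin-cong (M (suc a)) (λ h → sumFin-combine (M a) (M a) (λ y → f (combine {M (suc a)} h y) j))) ⟨
      6 * w * sumFin (M (suc a)) (λ h → sumFin (M (suc a)) (λ y → f (combine {M (suc a)} h y) j))
        ≡⟨ cong (6 * w *_) (sumFin-combine (M (suc a)) (M (suc a)) (λ i → f i j)) ⟨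
      6 * w * sumFin N (λ i → f i j) ∎

  totalCost : ℕ → Mem w → ℕ
  totalCost b μ = sumFin (M b) (λ i → localCost A μ (word S b i))

  totalCost-suc : ∀ b μ → totalCost (suc b) μ ≡
    M b * totalCost b μ + (sumFin (M b) (λ i → totalCost b (state A μ (word S b i))) +
      sumFin (M b) (λ i → sumFin (M b) (λ j → |IT| μ (word S b i) (word S b j))))
  totalCost-suc b μ = begin
    sumFin (N * N) (λ i → localCost A μ (word S (suc b) i))
      ≡⟨ sumFin-combine N N _ ⟩
    sumFin N (λ i → sumFin N (λ j → localCost A μ (word S (suc b) (combine {N} i j))))
      ≡⟨ sumFin-cong N (λ i → sumFin-cong N (λ j → trans (cong (localCost A μ) (word-combine S b i j)) (localCost-++ A μ (word S b i) (word S b j)))) ⟩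
    sumFin N (λ i → sumFin N (λ j → x i + (y i j + z i j)))
      ≡⟨ sumFin-cong N (λ i → trans (sumFin-+ N _ _) (cong₂ _+_ (sumFin-const N (x i)) (sumFin-+ N _ _))) ⟩
    sumFin N (λ i → N * x i + (sumFin N (y i) + sumFin N (z i)))
      ≡⟨ trans (sumFin-+ N _ _) (cong₂ _+_ (sumFin-* N N x) (sumFin-+ N _ _)) ⟩
    N * sumFin N x + (sumFin N (λ i → sumFin N (y i)) + sumFin N (λ i → sumFin N (z i))) ∎
    where
    open ≡-Reasoning
    N = M b
    x : Index S b → ℕ
    x i = localCost A μ (word S b i)
    y z : Index S b → Index S b → ℕ
    y i j = localCost A (state A μ (word S b i)) (word S b j)
    z i j = |IT| μ (word S b i) (word S b j)

  -- A period is charged `x * e * P` for each half and `e * (2 * P)` for its root. The second half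
  -- starts from a memory left by the first, hence the generality in `μ`. The levels up to `3 + k`,
  -- too short for the tests, contribute nothing.
  totalCost-lower : ∀ x → 2 ^ (3 + (x + k)) * m ≤ n → ∀ {μ R} → Correct μ R →
    M (3 + (x + k)) * (x * e * 2 ^ (x + k)) ≤ 6 * w * totalCost (3 + (x + k)) μ
  totalCost-lower zero    fits {μ} ok = ≤-trans (≤-reflexive (*-zeroʳ (M (3 + k)))) z≤n
  totalCost-lower (suc x) fits {μ} ok = begin
    N * N * (suc x * e * (2 * P))                        ≡⟨ split N x e P ⟩
    N * (N * β) + (N * (N * β) + N * (N * (e * (2 * P))))
      ≤⟨ +-mono-≤ (*-monoʳ-≤ N (totalCost-lower x fits′ ok)) (+-mono-≤
           (sumFin-lower N (6 * w) (N * β) _ (λ i → totalCost-lower x fits′ (Correct-state (word S b i) ok)))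
           (total-transfer (suc (x + k)) (s≤s (m≤n+m k x)) fits ok)) ⟩
    N * (6 * w * T) + (6 * w * U + 6 * w * V)            ≡⟨ join N (6 * w) T U V ⟩
    6 * w * (N * T + (U + V))                            ≡⟨ cong (6 * w *_) (totalCost-suc b μ) ⟨
    6 * w * totalCost (suc b) μ                          ∎
    where
    open ≤-Reasoning
    b = 3 + (x + k)
    N = M b
    P = 2 ^ (x + k)
    β = x * e * P
    T = totalCost b μ
    U = sumFin N (λ i → totalCost b (state A μ (word S b i)))
    V = sumFin N (λ i → sumFin N (λ j → |IT| μ (word S b i) (word S b j)))
    fits′ : 2 ^ b * m ≤ n
    fits′ = ≤-trans (*-monoˡ-≤ m (^-monoʳ-≤ 2 (n≤1+n b))) fits
    split : ∀ N x e P → N * N * (suc x * e * (2 * P)) ≡ N * (N * (x * e * P)) + (N * (N * (x * e * P)) + N * (N * (e * (2 * P))))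
    split = solve-∀
    join : ∀ N c T U V → N * (c * T) + (c * U + c * V) ≡ c * (N * T + (U + V))
    join = solve-∀

-- Signed sums over bit vectors

Σ<-cong : ∀ n {f g : ℕ → ℕ} → (∀ i → i < n → f i ≡ g i) → Σ< n f ≡ Σ< n g
Σ<-cong zero    eq = refl
Σ<-cong (suc n) eq = cong₂ _+_ (eq n ≤-refl) (Σ<-cong n (λ i i< → eq i (m≤n⇒m≤1+n i<)))

Σ<-const : ∀ n c → Σ< n (λ _ → c) ≡ n * c
Σ<-const zero    c = refl
Σ<-const (suc n) c = cong (c +_) (Σ<-const n c)

Σ<-split : ∀ a b f → Σ< (a + b) f ≡ Σ< a f + Σ< b (λ i → f (a + i))
Σ<-split a zero    f = trans (cong (λ n → Σ< n f) (+-identityʳ a)) (sym (+-identityʳ _))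
Σ<-split a (suc b) f = begin
  Σ< (a + suc b) f                                ≡⟨ cong (λ n → Σ< n f) (+-suc a b) ⟩
  f (a + b) + Σ< (a + b) f                        ≡⟨ cong (f (a + b) +_) (Σ<-split a b f) ⟩
  f (a + b) + (Σ< a f + Σ< b (λ i → f (a + i)))   ≡⟨ exchange (f (a + b)) (Σ< a f) _ ⟩
  Σ< a f + (f (a + b) + Σ< b (λ i → f (a + i)))   ∎
  where
  open ≡-Reasoning
  exchange : ∀ x y z → x + (y + z) ≡ y + (x + z)
  exchange = solve-∀

Σ<-interval : ∀ N a v f → a + v ≤ N → (∀ n → n < a → f n ≡ 0) → (∀ n → n < v → f (a + n) ≡ 1) →
  (∀ n → a + v ≤ n → f n ≡ 0) → Σ< N f ≡ v
Σ<-interval N a v f le before inside after = begin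
  Σ< N f                          ≡⟨ cong (λ n → Σ< n f) (m+[n∸m]≡n le) ⟨
  Σ< (a + v + (N ∸ (a + v))) f    ≡⟨ Σ<-split (a + v) (N ∸ (a + v)) f ⟩
  Σ< (a + v) f + Σ< (N ∸ (a + v)) (λ i → f (a + v + i))
    ≡⟨ cong₂ _+_ (Σ<-split a v f) (zeros (N ∸ (a + v)) (λ i _ → after (a + v + i) (m≤m+n (a + v) i))) ⟩
  Σ< a f + Σ< v (λ i → f (a + i)) + 0
    ≡⟨ cong₂ (λ x y → x + y + 0) (zeros a before) (trans (Σ<-cong v inside) (trans (Σ<-const v 1) (*-identityʳ v))) ⟩
  v + 0                           ≡⟨ +-identityʳ v ⟩
  v                               ∎
  where
  open ≡-Reasoning
  zeros : ∀ n {g} → (∀ i → i < n → g i ≡ 0) → Σ< n g ≡ 0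
  zeros n z = trans (Σ<-cong n z) (trans (Σ<-const n 0) (*-zeroʳ n))

divMod-unique : ∀ b .{{_ : NonZero b}} x y → x < b → (x + b * y) % b ≡ x × (x + b * y) / b ≡ y
divMod-unique b x y x<b = digits b (m%n<n d b) x<b (trans (cong (d % b +_) (*-comm b (d / b))) (sym (m≡m%n+[m/n]*n d b)))
  where d = x + b * y

neq-≡ : ∀ {N} {f s : Fin N} → f ≡ s → neq f s ≡ 0
neq-≡ {f = f} {s} = if-true (f ≟ᶠ s)

neq-≢ : ∀ {N} {f s : Fin N} → f ≢ s → neq f s ≡ 1
neq-≢ {f = f} {s} = if-false (f ≟ᶠ s)

-- Only used for x < 2 ^ δ, where the reduction is vacuous.
symbol : ∀ δ → ℕ → Sym δ
symbol δ x = fromℕ< (m%n<n x (2 ^ δ))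
  where instance _ = m^n≢0 2 δ

symbol-injective : ∀ δ {x y} → x < 2 ^ δ → y < 2 ^ δ → symbol δ x ≡ symbol δ y → x ≡ y
symbol-injective δ {x} {y} x< y< eq = begin
  x           ≡⟨ m<n⇒m%n≡m x< ⟨
  x % 2 ^ δ   ≡⟨ fromℕ<-injective _ _ (m%n<n x (2 ^ δ)) (m%n<n y (2 ^ δ)) eq ⟩
  y % 2 ^ δ   ≡⟨ m<n⇒m%n≡m y< ⟩
  y           ∎
  where
  open ≡-Reasoning
  instance _ = m^n≢0 2 δ

num : ∀ {k} → Vec Bool k → ℕ
num []              = 0
num {suc k} (b ∷ A) = (if b then 2 ^ k else 0) + num A

num< : ∀ {k} (A : Vec Bool k) → num A < 2 ^ k
num< []          = s≤s z≤n
num< {suc k} (true ∷ A)  = <-≤-trans (+-monoʳ-< (2 ^ k) (num< A)) (≤-reflexive (sym (2^suc k)))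
num< {suc k} (false ∷ A) = <-≤-trans (num< A) (m≤m+n (2 ^ k) _)

bits : ∀ k → ℕ → Vec Bool k
bits zero    r = []
bits (suc k) r = if does (r <? 2 ^ k) then false ∷ bits k r else true ∷ bits k (r ∸ 2 ^ k)

bits-num : ∀ {k} (A : Vec Bool k) → bits k (num A) ≡ A
bits-num []                  = refl
bits-num {suc k} (false ∷ A) = trans (if-true (num A <? 2 ^ k) (num< A)) (cong (false ∷_) (bits-num A))
bits-num {suc k} (true ∷ A)  = trans (if-false (2 ^ k + num A <? 2 ^ k) (m+n≮m (2 ^ k) (num A)))
  (cong (true ∷_) (trans (cong (bits k) (m+n∸m≡n (2 ^ k) (num A))) (bits-num A)))

Σvec : ∀ k → (Vec Bool k → ℤ) → ℤ
Σvec zero    f = f []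
Σvec (suc k) f = Σvec k (λ A → f (false ∷ A)) ℤ.+ Σvec k (λ A → f (true ∷ A))

Σvec-cong : ∀ k {f g : Vec Bool k → ℤ} → (∀ A → f A ≡ g A) → Σvec k f ≡ Σvec k g
Σvec-cong zero    eq = eq []
Σvec-cong (suc k) eq = cong₂ ℤ._+_ (Σvec-cong k (λ A → eq (false ∷ A))) (Σvec-cong k (λ A → eq (true ∷ A)))

Σvec-+ : ∀ k (f g : Vec Bool k → ℤ) → Σvec k (λ A → f A ℤ.+ g A) ≡ Σvec k f ℤ.+ Σvec k g
Σvec-+ zero    f g = refl
Σvec-+ (suc k) f g = trans (cong₂ ℤ._+_ (Σvec-+ k _ _) (Σvec-+ k _ _))
  (interchange (Σvec k (λ A → f (false ∷ A))) (Σvec k (λ A → g (false ∷ A))) _ _)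
  where
  interchange : ∀ a b c d → (a ℤ.+ b) ℤ.+ (c ℤ.+ d) ≡ (a ℤ.+ c) ℤ.+ (b ℤ.+ d)
  interchange = ℤ-Solver.solve-∀

Σvec-neg : ∀ k (f : Vec Bool k → ℤ) → Σvec k (λ A → - f A) ≡ - Σvec k f
Σvec-neg zero    f = refl
Σvec-neg (suc k) f = trans (cong₂ ℤ._+_ (Σvec-neg k _) (Σvec-neg k _))
  (sym (ℤ.neg-distrib-+ (Σvec k (λ A → f (false ∷ A))) _))

Σ<-Σvec : ∀ k f → pos (Σ< (2 ^ k) f) ≡ Σvec k (λ A → pos (f (num A)))
Σ<-Σvec zero    f = cong pos (+-identityʳ (f 0))
Σ<-Σvec (suc k) f = begin
  pos (Σ< (2 ^ suc k) f)                                    ≡⟨ cong (λ n → pos (Σ< n f)) (2^suc k) ⟩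
  pos (Σ< (2 ^ k + 2 ^ k) f)                                ≡⟨ cong pos (Σ<-split (2 ^ k) (2 ^ k) f) ⟩
  pos (Σ< (2 ^ k) f) ℤ.+ pos (Σ< (2 ^ k) (λ i → f (2 ^ k + i))) ≡⟨ cong₂ ℤ._+_ (Σ<-Σvec k f) (Σ<-Σvec k _) ⟩
  Σvec (suc k) (λ A → pos (f (num A)))                      ∎
  where open ≡-Reasoning

-- The sum of `f A` with sign (-1)^|A|, nested as one difference per coordinate because `lindström`
-- produces it in this form.
Σsigned : ∀ k → (Vec Bool k → ℤ) → ℤ
Σsigned zero    f = f []
Σsigned (suc k) f = Σsigned k (λ A → f (false ∷ A) ℤ.- f (true ∷ A))

Σsigned-cong : ∀ k {f g : Vec Bool k → ℤ} → (∀ A → f A ≡ g A) → Σsigned k f ≡ Σsigned k g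
Σsigned-cong zero    eq = eq []
Σsigned-cong (suc k) eq = Σsigned-cong k (λ A → cong₂ ℤ._-_ (eq (false ∷ A)) (eq (true ∷ A)))

weight : ∀ {k} → Vec Bool k → ℕ
weight []          = 0
weight (true ∷ C)  = suc (weight C)
weight (false ∷ C) = weight C

restrict : ∀ {k} (C : Vec Bool k) → Vec Bool k → Vec Bool (weight C)
restrict []          []      = []
restrict (true ∷ C)  (a ∷ A) = a ∷ restrict C A
restrict (false ∷ C) (a ∷ A) = restrict C A

-- Lindström's detecting matrix: cell C responds to test A through A ∩ C only,
-- so differencing the tests along the elements of C kills the cells that do
-- not contain C and leaves the signed sum of the response of C, up to cells
-- already known.
lindström : ∀ k (resp : ∀ l → Vec Bool l → ℕ → ℤ) (x x′ : Vec Bool k → ℕ) →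
  (∀ C → Σsigned (weight C) (λ B → resp (weight C) B (x C)) ≡ Σsigned (weight C) (λ B → resp (weight C) B (x′ C)) → x C ≡ x′ C) →
  (∀ A → Σvec k (λ C → resp (weight C) (restrict C A) (x C)) ≡ Σvec k (λ C → resp (weight C) (restrict C A) (x′ C))) →
  ∀ C → x C ≡ x′ C
lindström zero    resp x x′ det tests [] = det [] (tests [])
lindström (suc k) resp x x′ det tests = cells
  where
  part : Bool → (Vec Bool (suc k) → ℕ) → Vec Bool k → ℤ
  part b y A = Σvec k (λ C → resp (suc (weight C)) (b ∷ restrict C A) (y (true ∷ C)))
  base : (Vec Bool (suc k) → ℕ) → Vec Bool k → ℤ
  base y A = Σvec k (λ C → resp (weight C) (restrict C A) (y (false ∷ C)))

  differences : ∀ y A → Σvec k (λ C → resp (suc (weight C)) (false ∷ restrict C A) (y (true ∷ C)) ℤ.- resp (suc (weight C)) (true ∷ restrict C A) (y (true ∷ C)))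
    ≡ (base y A ℤ.+ part false y A) ℤ.- (base y A ℤ.+ part true y A)
  differences y A = trans (Σvec-+ k _ _) (trans (cong (λ s → part false y A ℤ.+ s) (Σvec-neg k _)) (cancel (base y A) (part false y A) (part true y A)))
    where
    cancel : ∀ u v z → v ℤ.+ - z ≡ (u ℤ.+ v) ℤ.- (u ℤ.+ z)
    cancel = ℤ-Solver.solve-∀

  containing : ∀ C → x (true ∷ C) ≡ x′ (true ∷ C)
  -- The difference along the first element is again a response, now of the shorter cell, so the
  -- induction continues with a new `resp`.
  containing = lindström k (λ l B v → resp (suc l) (false ∷ B) v ℤ.- resp (suc l) (true ∷ B) v) (λ C → x (true ∷ C)) (λ C → x′ (true ∷ C))
    (λ C → det (true ∷ C))
    (λ A → trans (differences x A) (trans (cong₂ ℤ._-_ (tests (false ∷ A)) (tests (true ∷ A))) (sym (differences x′ A))))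

  cells : ∀ C → x C ≡ x′ C
  cells (true ∷ C)  = containing C
  cells (false ∷ C) = lindström k resp (λ C → x (false ∷ C)) (λ C → x′ (false ∷ C)) (λ C → det (false ∷ C))
    (λ A → +ℤ-cancelʳ (part false x A) _ _ (trans (tests (false ∷ A))
      (cong (λ s → base x′ A ℤ.+ s) (Σvec-cong k (λ C → cong (resp (suc (weight C)) (false ∷ restrict C A)) (sym (containing C))))))) C

parity : ∀ {k} → Vec Bool k → Bool
parity []      = false
parity (b ∷ A) = b xor parity A

sign : Bool → ℤ
sign false = -1ℤ
sign true  = 1ℤ

-- `sign (parity A)` is opposite to the sign (-1)^|A| of the alternating sum, so every term ends up
-- with the sign -1.
Σsigned-parity : ∀ k (g : Vec Bool k → ℤ) → Σsigned k (λ A → sign (parity A) ℤ.* g A) ≡ - Σvec k g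
Σsigned-parity zero    g = ℤ.-1*i≡-i (g [])
Σsigned-parity (suc k) g = begin
  Σsigned k (λ A → sign (parity A) ℤ.* g (false ∷ A) ℤ.- sign (not (parity A)) ℤ.* g (true ∷ A))
    ≡⟨ Σsigned-cong k (λ A → merge (parity A) (g (false ∷ A)) (g (true ∷ A))) ⟩
  Σsigned k (λ A → sign (parity A) ℤ.* (g (false ∷ A) ℤ.+ g (true ∷ A)))
    ≡⟨ Σsigned-parity k _ ⟩
  - Σvec k (λ A → g (false ∷ A) ℤ.+ g (true ∷ A))
    ≡⟨ cong -_ (Σvec-+ k _ _) ⟩
  - Σvec (suc k) g ∎
  where
  open ≡-Reasoning
  merge : ∀ p a b → sign p ℤ.* a ℤ.- sign (not p) ℤ.* b ≡ sign p ℤ.* (a ℤ.+ b)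
  merge p a b = trans (cong (λ s → sign p ℤ.* a ℤ.- s ℤ.* b) (sign-not p)) (collect (sign p) a b)
    where
    sign-not : ∀ p → sign (not p) ≡ - sign p
    sign-not false = refl
    sign-not true  = refl
    collect : ∀ s a b → s ℤ.* a ℤ.- (- s) ℤ.* b ≡ s ℤ.* (a ℤ.+ b)
    collect = ℤ-Solver.solve-∀

neq-symbol-≢ : ∀ δ {x y} → x < 2 ^ δ → y < 2 ^ δ → x ≢ y → neq (symbol δ x) (symbol δ y) ≡ 1
neq-symbol-≢ δ x< y< x≢y = neq-≢ (λ eq → x≢y (symbol-injective δ x< y< eq))

-- Few bits per symbol: a block is 01 or 10, so that it always has a single
-- mismatch with the background 00.
module Binary {δ : ℕ} (δ>0 : 0 < δ) where

  private
    0< : 0 < 2 ^ δ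
    0< = 2^>0 δ

    1< : 1 < 2 ^ δ
    1< = ^-monoʳ-≤ 2 δ>0

  -- Distance 1 is excluded so that all marks are even: in an aligned block a mark can only face the
  -- newer symbol.
  marked? : ∀ d → Dec (2 ^ ⌊log₂ d ⌋ ≡ d × d ≢ 1)
  marked? d = (2 ^ ⌊log₂ d ⌋ ≟ d) ×-dec ¬? (d ≟ 1)

  fixedString : ℕ → Sym δ
  fixedString d = if does (marked? d) then symbol δ 1 else symbol δ 0

  code : Fin 2 → ℕ → Sym δ
  code c zero    = symbol δ (toℕ c)
  code c (suc _) = symbol δ (1 ∸ toℕ c)

  marked-even : ∀ {d} → 2 ^ ⌊log₂ d ⌋ ≡ d × d ≢ 1 → ∃ λ b → d ≡ 2 ^ b * 2
  marked-even {d} (pow , d≢1) with ⌊log₂ d ⌋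
  ... | zero  = contradiction (sym pow) d≢1
  ... | suc b = b , trans (sym pow) (*-comm 2 (2 ^ b))

  odd≢even : ∀ x y → x * 2 + 1 ≢ y * 2
  odd≢even zero    (suc y) ()
  odd≢even (suc x) (suc y) eq = odd≢even x y (suc-injective (suc-injective eq))

  pattern-odd : ∀ x → fixedString (x * 2 + 1) ≡ symbol δ 0
  pattern-odd x = if-false (marked? (x * 2 + 1)) λ mk → odd≢even x (2 ^ proj₁ (marked-even mk)) (proj₂ (marked-even mk))

  pattern-even : ∀ x → (∀ b → x ≢ 2 ^ b) → fixedString (x * 2) ≡ symbol δ 0
  pattern-even x not-pow = if-false (marked? (x * 2)) λ mk →
    not-pow (proj₁ (marked-even mk)) (*-cancelʳ-≡ x _ 2 (proj₂ (marked-even mk)))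

  pattern-mark : ∀ b → fixedString (2 ^ b * 2) ≡ symbol δ 1
  pattern-mark b = if-true (marked? (2 ^ b * 2)) (pow , λ eq → odd≢even 0 (2 ^ b) (sym eq))
    where
    pow : 2 ^ ⌊log₂ 2 ^ b * 2 ⌋ ≡ 2 ^ b * 2
    pow = trans (cong (2 ^_) (trans (cong ⌊log₂_⌋ (*-comm (2 ^ b) 2)) (⌊log₂[2^n]⌋≡n (suc b)))) (*-comm 2 (2 ^ b))

  private
    d01 : neq (symbol δ 0) (symbol δ 1) ≡ 1
    d01 = neq-symbol-≢ δ 0< 1< λ ()
    d10 : neq (symbol δ 1) (symbol δ 0) ≡ 1
    d10 = neq-symbol-≢ δ 1< 0< λ ()
    d00 : ∀ x → neq (symbol δ x) (symbol δ x) ≡ 0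
    d00 x = neq-≡ {f = symbol δ x} refl

    dist₂ : ℕ → Fin 2 → ℕ
    dist₂ s c = Σ< 2 (λ r → neq (fixedString (s + r)) (code c r))

    dist₂-eq : ∀ s x c → fixedString (s + 0) ≡ symbol δ x → fixedString (s + 1) ≡ symbol δ 0 →
      dist₂ s c ≡ neq (symbol δ 0) (code c 1) + (neq (symbol δ x) (code c 0) + 0)
    dist₂-eq s x c eq₀ eq₁ = cong₂ (λ f g → neq g (code c 1) + (neq f (code c 0) + 0)) eq₀ eq₁

    unmarked : ∀ c → neq (symbol δ 0) (code c 1) + (neq (symbol δ 0) (code c 0) + 0) ≡ 1
    unmarked Fin.zero           = cong₂ (λ f g → f + (g + 0)) d01 (d00 0)
    unmarked (Fin.suc Fin.zero) = cong₂ (λ f g → f + (g + 0)) (d00 0) d01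

    -- Facing a mark, one code word matches entirely and the other nowhere.
    mark-value : Fin 2 → ℕ
    mark-value Fin.zero    = 2
    mark-value (Fin.suc _) = 0

    at-mark : ∀ c → neq (symbol δ 0) (code c 1) + (neq (symbol δ 1) (code c 0) + 0) ≡ mark-value c
    at-mark Fin.zero           = cong₂ (λ f g → f + (g + 0)) d01 d10
    at-mark (Fin.suc Fin.zero) = cong₂ (λ f g → f + (g + 0)) (d00 0) (d00 1)

    mark-injective : ∀ c c′ → mark-value c ≡ mark-value c′ → c ≡ c′
    mark-injective Fin.zero           Fin.zero           _ = refl
    mark-injective (Fin.suc Fin.zero) (Fin.suc Fin.zero) _ = refl

  scheme : Scheme δ
  scheme = record
    { k = 1 ; e = 1 ; tests = 1
    ; G = fixedString ; code = code
    ; tests≤ = s≤s z≤n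
    ; silent = λ { zero z _ apart c c′ → trans (quiet z apart c) (sym (quiet z apart c′)) ; (suc _) z (s≤s ()) }
    ; detect = λ b _ c c′ eq → mark-injective c c′ (trans (sym (loud b c)) (trans (eq 0 (s≤s z≤n)) (loud b c′)))
    }
    where
    quiet : ∀ z → (∀ b → z ≢ 2 ^ b + 0) → ∀ c → dist₂ (z * 2) c ≡ 1
    quiet z apart c = trans (dist₂-eq (z * 2) 0 c
      (trans (cong fixedString (+-identityʳ (z * 2))) (pattern-even z λ b eq → apart b (trans eq (sym (+-identityʳ _)))))
      (pattern-odd z)) (unmarked c)
    loud : ∀ b c → dist₂ ((2 ^ b + 0) * 2) c ≡ mark-value c
    loud b c rewrite +-identityʳ (2 ^ b) = trans (dist₂-eq (2 ^ b * 2) 1 c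
      (trans (cong fixedString (+-identityʳ (2 ^ b * 2))) (pattern-mark b)) (pattern-odd (2 ^ b))) (at-mark c)

leaf : ∀ {Q} a → Fin (card Q a) → Vec Bool a → Fin Q
leaf         zero    c _           = c
leaf {Q} (suc a) i (false ∷ C) = leaf a (proj₁ (halves {card Q a} i)) C
leaf {Q} (suc a) i (true ∷ C)  = leaf a (proj₂ (halves {card Q a} i)) C

leaf-injective : ∀ {Q} a (i j : Fin (card Q a)) → (∀ C → leaf a i C ≡ leaf a j C) → i ≡ j
leaf-injective     zero    c d eq = eq []
leaf-injective {Q} (suc a) i j eq = halves-injective {card Q a} i j
  (leaf-injective a _ _ (λ C → eq (false ∷ C))) (leaf-injective a _ _ (λ C → eq (true ∷ C)))

weight-not : ∀ {a} (C : Vec Bool a) → weight C + weight (mapᵛ not C) ≡ a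
weight-not []          = refl
weight-not (true ∷ C)  = cong suc (weight-not C)
weight-not (false ∷ C) = trans (+-suc (weight C) _) (cong suc (weight-not C))

map-not-involutive : ∀ {a} (C : Vec Bool a) → mapᵛ not (mapᵛ not C) ≡ C
map-not-involutive []      = refl
map-not-involutive (b ∷ C) = cong₂ _∷_ (not-involutive b) (map-not-involutive C)

-- Values displayed to a single cell

module Detecting (t : ℕ) where

  q : ℕ
  q = 2 ^ t

  private instance
    q≢0 : NonZero q
    q≢0 = m^n≢0 2 t

  -- The value v is taken by the v numbers v * q + y with y < v < q.
  value : ℕ → Maybe ℕ
  value n = if does ((n % q <? n / q) ×-dec (n / q <? q)) then just (n / q) else nothing

  hit : Maybe ℕ → ℕ → ℕ
  hit nothing  v = 0
  hit (just a) v = if does (a ≟ v) then 1 else 0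

  miss : Maybe ℕ → ℕ → ℕ
  miss nothing  v = 1
  miss (just a) v = if does (a ≟ v) then 0 else 1

  miss-hit : ∀ M v → pos (miss M v) ≡ 1ℤ ℤ.- pos (hit M v)
  miss-hit nothing  v = refl
  miss-hit (just a) v with does (a ≟ v)
  ... | true  = refl
  ... | false = refl

  private
    value? : ∀ n → Dec (n % q < n / q × n / q < q)
    value? n = (n % q <? n / q) ×-dec (n / q <? q)

    value-case : ∀ n → Dec (n % q < n / q × n / q < q) →
      (∀ {P : Maybe ℕ → Set} → P nothing → (n % q < n / q → n / q < q → P (just (n / q))) → P (value n))
    value-case n (yes (y< , a<)) {P} _ f = subst P (sym (if-true (value? n) (y< , a<))) (f y< a<)
    value-case n (no ¬p) {P} z _         = subst P (sym (if-false (value? n) ¬p)) z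

    decompose : ∀ n → n ≡ (n / q) * q + n % q
    decompose n = trans (m≡m%n+[m/n]*n n q) (+-comm (n % q) _)

  value< : ∀ n a → value n ≡ just a → a < q
  value< n a = value-case n (value? n) {λ M → M ≡ just a → a < q} (λ ()) λ { _ a< refl → a< }

  hit-inside : ∀ v y → v < q → y < v → hit (value (v * q + y)) v ≡ 1
  hit-inside v y v<q y<v = begin
    hit (value (v * q + y)) v   ≡⟨ cong (λ n → hit (value n) v) (trans (+-comm (v * q) y) (cong (y +_) (*-comm v q))) ⟩
    hit (value n) v             ≡⟨ cong (λ M → hit M v) (if-true (value? n) (subst₂ _<_ (sym n%q) (sym n/q) y<v , subst (_< q) (sym n/q) v<q)) ⟩
    hit (just (n / q)) v        ≡⟨ if-true (n / q ≟ v) n/q ⟩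
    1                           ∎
    where
    open ≡-Reasoning
    n = y + q * v
    n%q : n % q ≡ y
    n%q = proj₁ (divMod-unique q y v (<-trans y<v v<q))
    n/q : n / q ≡ v
    n/q = proj₂ (divMod-unique q y v (<-trans y<v v<q))

  hit-outside : ∀ v n → ¬ (v * q ≤ n × n < v * q + v) → hit (value n) v ≡ 0
  hit-outside v n miss-range = value-case n (value? n) {λ M → hit M v ≡ 0} refl
    λ y< _ → if-false (n / q ≟ v) λ eq → miss-range (subst (λ a → a * q ≤ n × n < a * q + a) eq
      ( subst (n / q * q ≤_) (sym (decompose n)) (m≤m+n _ (n % q))
      , subst (_< n / q * q + n / q) (sym (decompose n)) (+-monoʳ-< (n / q * q) y<)))

  -- The numbers that take the value `v` lie below `q * q`, which is `2 ^ (2 * t)`, so `2 * t` bits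
  -- are enough to meet them all.
  count-hits : ∀ l v → v < q → 2 * t ≤ l → Σ< (2 ^ l) (λ n → hit (value n) v) ≡ v
  count-hits l v v<q 2t≤l = Σ<-interval (2 ^ l) (v * q) v _ fits
    (λ n n< → hit-outside v n λ (≤n , _) → <⇒≱ n< ≤n)
    (λ n → hit-inside v n v<q)
    (λ n ≤n → hit-outside v n λ (_ , n<) → <⇒≱ n< ≤n)
    where
    open ≤-Reasoning
    fits : v * q + v ≤ 2 ^ l
    fits = begin
      v * q + v    ≤⟨ +-monoʳ-≤ (v * q) (<⇒≤ v<q) ⟩
      v * q + q    ≡⟨ +-comm (v * q) q ⟩
      suc v * q    ≤⟨ *-monoˡ-≤ q v<q ⟩
      q * q        ≡⟨ ^-distribˡ-+-* 2 t t ⟨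
      2 ^ (t + t)  ≤⟨ ^-monoʳ-≤ 2 (≤-trans (≤-reflexive (cong (t +_) (sym (+-identityʳ t)))) 2t≤l) ⟩
      2 ^ l        ∎

  -- Vectors of odd parity show nothing, so the signed count of a value is a
  -- plain count.
  shown : ∀ {l} → Vec Bool l → Maybe ℕ
  shown []      = nothing
  shown (b ∷ B) = if b xor parity B then nothing else value (num B)

  shown< : ∀ {l} (B : Vec Bool l) a → shown B ≡ just a → a < q
  shown< (b ∷ B) a with b xor parity B
  ... | false = value< (num B) a
  ... | true  = λ ()

  -- Exactly one of `false ∷ B` and `true ∷ B` has even parity and displays the value of `num B`;
  -- with the signs, every `B` contributes minus its hits. The bit spent on parity explains the
  -- strict `2 * t < l`.
  Σsigned-shown : ∀ l v → v < q → 2 * t < l → Σsigned l (λ B → pos (miss (shown B) v)) ≡ - pos v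
  Σsigned-shown (suc l) v v<q (s≤s 2t≤l) = begin
    Σsigned l (λ B → pos (miss (shown (false ∷ B)) v) ℤ.- pos (miss (shown (true ∷ B)) v))
      ≡⟨ Σsigned-cong l (λ B → step B (parity B)) ⟩
    Σsigned l (λ B → sign (parity B) ℤ.* pos (hit (value (num B)) v))
      ≡⟨ Σsigned-parity l _ ⟩
    - Σvec l (λ B → pos (hit (value (num B)) v))
      ≡⟨ cong -_ (Σ<-Σvec l (λ n → hit (value n) v)) ⟨
    - pos (Σ< (2 ^ l) (λ n → hit (value n) v))
      ≡⟨ cong (λ n → - pos n) (count-hits l v v<q 2t≤l) ⟩
    - pos v ∎
    where
    open ≡-Reasoning
    step : ∀ B p →
      pos (miss (if false xor p then nothing else value (num B)) v) ℤ.-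
      pos (miss (if true xor p then nothing else value (num B)) v) ≡
      sign p ℤ.* pos (hit (value (num B)) v)
    step B p with value (num B)
    step B false | M = trans (cong (ℤ._- 1ℤ) (miss-hit M v)) (trans (negate (pos (hit M v))) (sym (ℤ.-1*i≡-i (pos (hit M v)))))
      where
      negate : ∀ x → (1ℤ ℤ.- x) ℤ.- 1ℤ ≡ - x
      negate x = trans (ℤ.+-comm (1ℤ ℤ.- x) -1ℤ) (trans (sym (ℤ.+-assoc -1ℤ 1ℤ (- x))) (ℤ.+-identityˡ (- x)))
    step B true  | M = trans (cong (λ y → 1ℤ ℤ.- y) (miss-hit M v)) (trans (back (pos (hit M v))) (sym (ℤ.*-identityˡ (pos (hit M v)))))
      where
      back : ∀ x → 1ℤ ℤ.- (1ℤ ℤ.- x) ≡ x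
      back x = trans (cong (λ y → 1ℤ ℤ.+ y) (ℤ.neg-distrib-+ 1ℤ (- x)))
        (trans (sym (ℤ.+-assoc 1ℤ -1ℤ (- (- x)))) (trans (ℤ.+-identityˡ (- (- x))) (ℤ.neg-involutive x)))

-- Many bits per symbol: a nonblank symbol carries a position r < m within the
-- block and a value a < q, and blank is 0. Positions only match when aligned.
module Lindström {δ : ℕ} (t : ℕ) (room : 2 + 4 * t + t < δ) where

  open Detecting t

  -- Complementary cells have weights adding up to `k`, which is `2 + 4 * t`, so one of each pair
  -- exceeds `2 * t`; the `2 ^ κ` pairs carry `t` bits each.
  κ k m e : ℕ
  κ = 1 + 4 * t
  k = suc κ
  m = 2 ^ k
  e = t * 2 ^ κ

  private instance
    m≢0 : NonZero m
    m≢0 = m^n≢0 2 k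
    2m≢0 : NonZero (2 * m)
    2m≢0 = m^n≢0 2 (suc k)

  private
    sy : ℕ → Sym δ
    sy = symbol δ

  encode : ℕ → Maybe ℕ → ℕ
  encode r nothing  = 0
  encode r (just a) = suc (r + m * a)

  encode< : ∀ r M → r < m → (∀ a → M ≡ just a → a < q) → encode r M < 2 ^ δ
  encode< r nothing  r<m a<q = 2^>0 δ
  encode< r (just a) r<m a<q = begin-strict
    suc r + m * a    ≤⟨ +-monoˡ-≤ (m * a) r<m ⟩
    m + m * a        ≡⟨ *-suc m a ⟨
    m * suc a        ≤⟨ *-monoʳ-≤ m (a<q a refl) ⟩
    m * q            ≡⟨ ^-distribˡ-+-* 2 k t ⟨
    2 ^ (k + t)      <⟨ ^-monoʳ-< 2 (s≤s (s≤s z≤n)) room ⟩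
    2 ^ δ            ∎
    where open ≤-Reasoning

  response : Vec Bool k → Vec Bool k → Maybe ℕ
  response A C = shown (restrict C A)

  at : ℕ → ℕ → Maybe ℕ
  at i r = response (bits k i) (bits k r)

  PatternCell : ℕ → ℕ → ℕ → Set
  PatternCell i ρ P = i ≤ ρ × ρ ∸ i < m × 2 ^ ⌊log₂ P ⌋ ≡ P

  patternCell? : ∀ i ρ P → Dec (PatternCell i ρ P)
  patternCell? i ρ P = (i ≤? ρ) ×-dec (ρ ∸ i <? m) ×-dec (2 ^ ⌊log₂ P ⌋ ≟ P)

  cellSymbol : ℕ → ℕ → ℕ → Sym δ
  cellSymbol i ρ P = if does (patternCell? i ρ P) then sy (encode (ρ ∸ i) (at i (ρ ∸ i))) else sy 0

  -- The inverse of (P , i , r) ↦ (i + r) + 2m (i + m P), with P a power of two.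
  fixedString : ℕ → Sym δ
  fixedString d = cellSymbol ((d / (2 * m)) % m) (d % (2 * m)) ((d / (2 * m)) / m)

  distance : ℕ → ℕ → ℕ
  distance b i = i + (2 ^ b + 2 * i) * m

  -- By `k < b` the distance is `(i + r) + 2 * m * (i + m * P)`. The summand `2 * i` of the test
  -- distance thus records `i` a second time, which allows `r` to be separated from `i + r < 2 * m`.
  pattern-at : ∀ b i r → k < b → i < m → r < m → fixedString (distance b i + r) ≡ sy (encode r (at i r))
  pattern-at b i r k<b i<m r<m = begin
    fixedString (distance b i + r)      ≡⟨ cong fixedString d≡ ⟩
    fixedString d                       ≡⟨ cong₂ (λ ρ Q → cellSymbol (Q % m) ρ (Q / m)) (proj₁ outer) (proj₂ outer) ⟩
    cellSymbol ((i + m * P) % m) (i + r) ((i + m * P) / m) ≡⟨ cong₂ (λ i′ P′ → cellSymbol i′ (i + r) P′) (proj₁ inner) (proj₂ inner) ⟩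
    cellSymbol i (i + r) P           ≡⟨ if-true (patternCell? i (i + r) P)
      (m≤m+n i r , subst (_< m) (sym (m+n∸m≡n i r)) r<m , cong (2 ^_) (⌊log₂[2^n]⌋≡n (b ∸ suc k))) ⟩
    sy (encode (i + r ∸ i) (at i (i + r ∸ i))) ≡⟨ cong (λ r → sy (encode r (at i r))) (m+n∸m≡n i r) ⟩
    sy (encode r (at i r))           ∎
    where
    open ≡-Reasoning
    P = 2 ^ (b ∸ suc k)
    d = (i + r) + 2 * m * (i + m * P)
    outer : d % (2 * m) ≡ i + r × d / (2 * m) ≡ i + m * P
    outer = divMod-unique (2 * m) (i + r) (i + m * P) (<-≤-trans (+-mono-< i<m r<m) (≤-reflexive (sym (2^suc k))))
    inner : (i + m * P) % m ≡ i × (i + m * P) / m ≡ P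
    inner = divMod-unique m i P i<m
    2^b : 2 ^ b ≡ 2 * m * P
    2^b = trans (cong (2 ^_) (sym (m+[n∸m]≡n k<b))) (^-distribˡ-+-* 2 (suc k) (b ∸ suc k))
    regroup : ∀ i r m P → i + (2 * m * P + 2 * i) * m + r ≡ (i + r) + 2 * m * (i + m * P)
    regroup = solve-∀
    d≡ : distance b i + r ≡ d
    d≡ = trans (cong (λ x → i + (x + 2 * i) * m + r) 2^b) (regroup i r m P)

  -- A match forces the pattern symbol to carry position `r`. Then `i` and `z` can be read off the
  -- distance, and `z` comes out as a power of two plus `2 * i`.
  pattern-apart : ∀ i z r v → i < m → r < m → v < q → (∀ b → z ≢ 2 ^ b + 2 * i) →
    neq (fixedString (i + z * m + r)) (sy (encode r (just v))) ≡ 1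
  pattern-apart i z r v i<m r<m v<q apart = cases (patternCell? i′ ρ P)
    where
    d Q i′ ρ P r′ : ℕ
    d = i + z * m + r
    Q = d / (2 * m)
    i′ = Q % m
    ρ = d % (2 * m)
    P = Q / m
    r′ = ρ ∸ i′
    encv< : encode r (just v) < 2 ^ δ
    encv< = encode< r (just v) r<m λ { _ refl → v<q }
    cases : Dec (PatternCell i′ ρ P) → neq (fixedString d) (sy (encode r (just v))) ≡ 1
    cases (no ¬cell) = trans (cong (λ f → neq f (sy (encode r (just v)))) (if-false (patternCell? i′ ρ P) ¬cell))
      (neq-symbol-≢ δ (2^>0 δ) encv< λ ())
    cases (yes cell@(i′≤ρ , r′<m , pow)) = trans (cong (λ f → neq f (sy (encode r (just v)))) (if-true (patternCell? i′ ρ P) cell))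
      (neq-symbol-≢ δ (encode< r′ (at i′ r′) r′<m (λ a → shown< (restrict (bits k r′) (bits k i′)) a)) encv< (differ (at i′ r′)))
      where
      differ : ∀ M → encode r′ M ≢ encode r (just v)
      differ nothing  ()
      differ (just a) eq = apart (suc (⌊log₂ P ⌋ + k)) (trans z≡ (trans (cong (λ x → 2 * (i′ + m * x)) (sym pow)) power))
        where
        r′≡r : r′ ≡ r
        r′≡r = proj₁ (digits m r′<m r<m (suc-injective eq))
        open ≡-Reasoning
        recompose : i + m * z + r ≡ i′ + m * (2 * (i′ + m * P)) + r
        recompose = begin
          i + m * z + r                   ≡⟨ cong (λ x → i + x + r) (*-comm m z) ⟩
          d                               ≡⟨ m≡m%n+[m/n]*n d (2 * m) ⟩
          ρ + Q * (2 * m)                 ≡⟨ cong₂ (λ x y → x + y * (2 * m)) (trans (sym (m+[n∸m]≡n i′≤ρ)) (cong (i′ +_) r′≡r)) (m≡m%n+[m/n]*n Q m) ⟩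
          i′ + r + (i′ + P * m) * (2 * m) ≡⟨ shuffle i′ r P m ⟩
          i′ + m * (2 * (i′ + m * P)) + r ∎
          where
          shuffle : ∀ i r P m → i + r + (i + P * m) * (2 * m) ≡ i + m * (2 * (i + m * P)) + r
          shuffle = solve-∀
        split : i ≡ i′ × z ≡ 2 * (i′ + m * P)
        split = digits m i<m (m%n<n Q m) (+-cancelʳ-≡ r _ _ recompose)
        z≡ : z ≡ 2 * (i′ + m * P)
        z≡ = proj₂ split
        power : 2 * (i′ + m * 2 ^ ⌊log₂ P ⌋) ≡ 2 ^ suc (⌊log₂ P ⌋ + k) + 2 * i
        power = begin
          2 * (i′ + m * 2 ^ ⌊log₂ P ⌋)          ≡⟨ cong (λ x → 2 * (x + m * 2 ^ ⌊log₂ P ⌋)) (proj₁ split) ⟨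
          2 * (i + m * 2 ^ ⌊log₂ P ⌋)           ≡⟨ swap i m (2 ^ ⌊log₂ P ⌋) ⟩
          2 * (2 ^ ⌊log₂ P ⌋ * m) + 2 * i       ≡⟨ cong (λ x → 2 * x + 2 * i) (^-distribˡ-+-* 2 ⌊log₂ P ⌋ k) ⟨
          2 ^ suc (⌊log₂ P ⌋ + k) + 2 * i       ∎
          where
          swap : ∀ i m x → 2 * (i + m * x) ≡ 2 * (x * m) + 2 * i
          swap = solve-∀

  Digits : Set
  Digits = Fin (card q κ)

  -- Only cells of weight more than 2t are used; C or its complement is one.
  cellValue : Digits → Vec Bool k → ℕ
  cellValue c (b ∷ C) = if does (2 * t <? weight (b ∷ C)) then toℕ (leaf κ c (if b then mapᵛ not C else C)) else 0

  private
    big? : ∀ C → Dec (2 * t < weight {k} C)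
    big? C = 2 * t <? weight C

  cellValue< : ∀ c C → cellValue c C < q
  cellValue< c (b ∷ C) with does (2 * t <? weight (b ∷ C))
  ... | true  = toℕ<n (leaf κ c (if b then mapᵛ not C else C))
  ... | false = 2^>0 t

  cellValue-small : ∀ c C → ¬ 2 * t < weight C → cellValue c C ≡ 0
  cellValue-small c (b ∷ C) ¬big = if-false (big? (b ∷ C)) ¬big

  cellValue-big : ∀ c b C → 2 * t < weight (b ∷ C) → cellValue c (b ∷ C) ≡ toℕ (leaf κ c (if b then mapᵛ not C else C))
  cellValue-big c b C big = if-true (big? (b ∷ C)) big

  cellValue-injective : ∀ c c′ → (∀ C → cellValue c C ≡ cellValue c′ C) → c ≡ c′
  cellValue-injective c c′ eq = leaf-injective κ c c′ λ C → toℕ-injective (same C (big? (false ∷ C)))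
    where
    open ≡-Reasoning
    same : ∀ C → Dec (2 * t < weight C) → toℕ (leaf κ c C) ≡ toℕ (leaf κ c′ C)
    same C (yes big) = trans (sym (cellValue-big c false C big)) (trans (eq (false ∷ C)) (cellValue-big c′ false C big))
    -- The digit of a light cell is read from the complementary cell, which stores it too.
    same C (no ¬big) = begin
      toℕ (leaf κ c C)                       ≡⟨ cong (λ D → toℕ (leaf κ c D)) (map-not-involutive C) ⟨
      toℕ (leaf κ c (mapᵛ not (mapᵛ not C)))   ≡⟨ cellValue-big c true (mapᵛ not C) big ⟨
      cellValue c (true ∷ mapᵛ not C)         ≡⟨ eq (true ∷ mapᵛ not C) ⟩
      cellValue c′ (true ∷ mapᵛ not C)        ≡⟨ cellValue-big c′ true (mapᵛ not C) big ⟩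
      toℕ (leaf κ c′ (mapᵛ not (mapᵛ not C)))  ≡⟨ cong (λ D → toℕ (leaf κ c′ D)) (map-not-involutive C) ⟩
      toℕ (leaf κ c′ C)                      ∎
      where
      double : ∀ t → 1 + 4 * t ≡ 2 * t + (1 + 2 * t)
      double = solve-∀
      big : 2 * t < weight (true ∷ mapᵛ not C)
      big = s≤s (≤-trans (n≤1+n (2 * t)) (+-cancelˡ-≤ (weight C) _ _ (≤-trans (+-monoˡ-≤ (1 + 2 * t) (≮⇒≥ ¬big))
        (≤-reflexive (trans (sym (double t)) (sym (weight-not C)))))))

  digitsOf : Fin (2 ^ e) → Digits
  digitsOf = subst Fin (sym (card-2^ t κ))

  code : Fin (2 ^ e) → ℕ → Sym δ
  code c r = sy (encode r (just (cellValue (digitsOf c) (bits k r))))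

  private
    blockDist : ℕ → Fin (2 ^ e) → ℕ
    blockDist s c = Σ< m (λ r → neq (fixedString (s + r)) (code c r))

  blockDist-apart : ∀ i z → i < m → (∀ b → z ≢ 2 ^ b + 2 * i) → ∀ c → blockDist (i + z * m) c ≡ Σ< m (λ _ → 1)
  blockDist-apart i z i<m apart c = Σ<-cong m λ r r<m →
    pattern-apart i z r (cellValue (digitsOf c) (bits k r)) i<m r<m (cellValue< (digitsOf c) (bits k r)) apart

  neq-encode : ∀ r M v → r < m → (∀ a → M ≡ just a → a < q) → v < q →
    neq (sy (encode r M)) (sy (encode r (just v))) ≡ miss M v
  neq-encode r M v r<m a<q v<q = cases M a<q
    where
    encv< : encode r (just v) < 2 ^ δ
    encv< = encode< r (just v) r<m λ { _ refl → v<q }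
    cases : ∀ M → (∀ a → M ≡ just a → a < q) → neq (sy (encode r M)) (sy (encode r (just v))) ≡ miss M v
    cases nothing  _   = neq-symbol-≢ δ (2^>0 δ) encv< λ ()
    cases (just a) a<q = by (a ≟ v)
      where
      by : Dec (a ≡ v) → neq (sy (encode r (just a))) (sy (encode r (just v))) ≡ miss (just a) v
      by (yes a≡v) = trans (neq-≡ (cong (λ a → sy (encode r (just a))) a≡v)) (sym (if-true (a ≟ v) a≡v))
      by (no a≢v)  = trans (neq-symbol-≢ δ (encode< r (just a) r<m a<q) encv<
        (λ eq → a≢v (proj₂ (digits m r<m r<m (suc-injective eq))))) (sym (if-false (a ≟ v) a≢v))

  blockDist-test : ∀ b A c → k < b → pos (blockDist (distance b (num A)) c) ≡
    Σvec k (λ C → pos (miss (shown (restrict C A)) (cellValue (digitsOf c) C)))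
  blockDist-test b A c k<b = begin
    pos (blockDist (distance b (num A)) c)
      ≡⟨ cong pos (Σ<-cong m λ r r<m → trans
           (cong (λ f → neq f (code c r)) (pattern-at b (num A) r k<b (num< A) r<m))
           (neq-encode r (at (num A) r) (val (bits k r)) r<m
             (λ a → shown< (restrict (bits k r) (bits k (num A))) a) (cellValue< (digitsOf c) (bits k r)))) ⟩
    pos (Σ< m (λ r → miss (response (bits k (num A)) (bits k r)) (val (bits k r))))
      ≡⟨ Σ<-Σvec k _ ⟩
    Σvec k (λ C → pos (miss (response (bits k (num A)) (bits k (num C))) (val (bits k (num C)))))
      ≡⟨ Σvec-cong k (λ C → cong₂ (λ B D → pos (miss (response B D) (val D))) (bits-num A) (bits-num C)) ⟩
    Σvec k (λ C → pos (miss (response A C) (val C))) ∎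
    where
    open ≡-Reasoning
    val = cellValue (digitsOf c)

  -- A light cell holds `0` in every code word, so it has nothing to recover; for a heavy one the
  -- signed sum is minus its value.
  cellValue-determined : ∀ c c′ C →
    Σsigned (weight C) (λ B → pos (miss (shown B) (cellValue c C))) ≡
    Σsigned (weight C) (λ B → pos (miss (shown B) (cellValue c′ C))) → cellValue c C ≡ cellValue c′ C
  cellValue-determined c c′ C eq = by (big? C)
    where
    by : Dec (2 * t < weight C) → cellValue c C ≡ cellValue c′ C
    by (no ¬big) = trans (cellValue-small c C ¬big) (sym (cellValue-small c′ C ¬big))
    by (yes big) = ℤ.+-injective (ℤ.neg-injective (trans
      (sym (Σsigned-shown (weight C) _ (cellValue< c C) big)) (trans eq (Σsigned-shown (weight C) _ (cellValue< c′ C) big))))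

  scheme : Scheme δ
  scheme = record
    { k = k ; e = e ; tests = m
    ; G = fixedString ; code = code
    ; tests≤ = ≤-refl
    ; silent = λ i z i<m apart c c′ → trans (blockDist-apart i z i<m apart c) (sym (blockDist-apart i z i<m apart c′))
    ; detect = λ b k<b c c′ eq → subst-injective (sym (card-2^ t κ)) (cellValue-injective _ _
        (lindström k (λ l B v → pos (miss (shown B) v)) _ _ (cellValue-determined (digitsOf c) (digitsOf c′))
          (λ A → trans (sym (blockDist-test b A c k<b)) (trans (cong pos (eq (num A) (num< A))) (blockDist-test b A c′ k<b)))))
    }

-- Randomised algorithms and the choice of parameters

vecOf : ∀ {A : Set} {n} (l : List A) → length l ≡ n → Σ (Vec A n) λ v → toList v ≡ l
vecOf l refl = fromList l , toList∘fromList l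

log-lower : ∀ a {n} → 2 ^ a ≤ n → a ≤ ⌊log₂ n ⌋
log-lower a {n} le = subst (_≤ ⌊log₂ n ⌋) (⌊log₂[2^n]⌋≡n a) (⌊log₂⌋-mono-≤ le)

n<2^[1+log] : ∀ n → n < 2 ^ suc ⌊log₂ n ⌋
n<2^[1+log] n = ≰⇒> λ le → <-irrefl refl (log-lower (suc ⌊log₂ n ⌋) le)

2^log≤n : ∀ n → 0 < n → 2 ^ ⌊log₂ n ⌋ ≤ n
2^log≤n n n>0 = go ⌊log₂ n ⌋ n n>0 refl
  where
  double-half : ∀ n → 2 * ⌊ n /2⌋ ≤ n
  double-half zero          = z≤n
  double-half (suc zero)    = z≤n
  double-half (suc (suc n)) = ≤-trans (≤-reflexive (*-suc 2 ⌊ n /2⌋)) (s≤s (s≤s (double-half n)))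
  go : ∀ a n → 0 < n → ⌊log₂ n ⌋ ≡ a → 2 ^ a ≤ n
  go zero    n             n>0 eq = n>0
  go (suc a) (suc zero)    n>0 ()
  go (suc a) (suc (suc n)) n>0 eq = ≤-trans
    (*-monoʳ-≤ 2 (go a ⌊ suc (suc n) /2⌋ (s≤s z≤n)
      (trans (⌊log₂⌊n/2⌋⌋≡⌊log₂n⌋∸1 (suc (suc n))) (cong (_∸ 1) eq))))
    (double-half (suc (suc n)))

module _ {δ : ℕ} (S : Scheme δ) where

  open Scheme S

  background : ℕ → Sym δ
  background _ = symbol δ 0

  -- The `A r` are the equally likely seeds of a randomised algorithm. Each obeys the averaged bound
  -- over the same family of words, so their sum does too, and some word attains it. Padding brings
  -- the words to length `n`.
  randomised-lower : ∀ n w → 0 < w → ∀ x → 2 ^ (3 + (x + k)) * m ≤ n →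
    ∀ K (A : Fin (suc K) → Algorithm δ w) → (∀ r → Solves (window n G) (window n background) (A r)) →
    Σ (Vec (Sym δ) n) λ xs →
      suc K * (x * e * 2 ^ (x + k)) ≤ 6 * w * sumFin (suc K) (λ r → cost (A r) (toList xs))
  randomised-lower n w w>0 x fits K A solves = proj₁ (input best) ,
    subst (λ l → suc K * β ≤ 6 * w * sumFin (suc K) (λ r → cost (A r) l)) (sym (proj₂ (input best))) (proj₂ averaged)
    where
    b = 3 + (x + k)
    M = card (2 ^ e) b
    β = x * e * 2 ^ (x + k)
    padding : List (Sym δ)
    padding = replicate (n ∸ 2 ^ b * m) (symbol δ 0)
    padded : Index S b → List (Sym δ)
    padded i = word S b i ++ padding
    length-padded : ∀ i → length (padded i) ≡ n
    length-padded i = trans (length-++ (word S b i))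
      (trans (cong₂ _+_ (length-word S b i) (length-replicate _)) (m+[n∸m]≡n fits))
    input : ∀ i → Σ (Vec (Sym δ) n) λ v → toList v ≡ padded i
    input i = vecOf (padded i) (length-padded i)
    open ≤-Reasoning
    per-seed : ∀ r → M * β ≤ 6 * w * sumFin M (λ i → cost (A r) (padded i))
    per-seed r = begin
      M * β                                          ≤⟨ totalCost-lower S (A r) w>0 n x fits correct ⟩
      6 * w * totalCost S (A r) w>0 n b (initMem (A r)) ≤⟨ *-monoʳ-≤ (6 * w) (sumFin-mono M (λ i → localCost≤cost (A r) (word S b i) padding)) ⟩
      6 * w * sumFin M (λ i → cost (A r) (padded i)) ∎
      where
      correct : Correct S (A r) w>0 n (initMem (A r)) background
      correct xs = trans (sym (outputs-spec (A r) xs)) (trans (solves r xs) (hammingOutputs-window δ G n background xs))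
    M>0 : 0 < M
    M>0 = subst (0 <_) (sym (card-2^ e b)) (2^>0 (e * 2 ^ b))
    swap : ∀ a b c → a * (b * c) ≡ b * (a * c)
    swap = solve-∀
    expected : M * (suc K * β) ≤ sumFin M (λ i → 6 * w * sumFin (suc K) (λ r → cost (A r) (padded i)))
    expected = begin
      M * (suc K * β)   ≡⟨ swap M (suc K) β ⟩
      suc K * (M * β)   ≤⟨ sumFin-lower (suc K) (6 * w) (M * β) _ per-seed ⟩
      6 * w * sumFin (suc K) (λ r → sumFin M (λ i → cost (A r) (padded i)))
                        ≡⟨ cong (6 * w *_) (sumFin-swap (suc K) M (λ r i → cost (A r) (padded i))) ⟩
      6 * w * sumFin M (λ i → sumFin (suc K) (λ r → cost (A r) (padded i)))
                        ≡⟨ sumFin-* M (6 * w) (λ i → sumFin (suc K) (λ r → cost (A r) (padded i))) ⟨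
      sumFin M (λ i → 6 * w * sumFin (suc K) (λ r → cost (A r) (padded i))) ∎
    averaged : ∃ λ i → suc K * β ≤ 6 * w * sumFin (suc K) (λ r → cost (A r) (padded i))
    averaged = average M _ (suc K * β) M>0 expected
    best = proj₁ averaged

-- A scheme with blocks of length 2 ^ k leaves log n - 2k - 3 useful levels.
record Parameters (δ L : ℕ) : Set where
  constructor parameters
  field
    scheme : Scheme δ
  open Scheme scheme
  field
    rate levels y : ℕ
    levels-eq : 3 + (levels + k) + k ≡ L
    top-eq    : L ≡ 4 + y
    rate-eq   : e * 2 ^ (levels + k) ≡ rate * 2 ^ y
    δ≤        : δ ≤ 64 * rate
    L≤        : L ≤ 2 * levels

-- Below 32 bits the binary scheme loses only a constant factor. Otherwise `t` is `δ / 32`: the lost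
-- levels number `3 + 2 * k`, that is `7 + 8 * t`, and twice this is at most `L` because `28 ≤ L`
-- and `32 * t ≤ δ ≤ L`.
chooseParameters : ∀ δ L → 28 ≤ L → 1 ≤ δ → δ ≤ L → Parameters δ L
chooseParameters δ L 28≤L 1≤δ δ≤L with 32 ≤? δ
... | no δ<32 = parameters (Binary.scheme 1≤δ) 1 x (x + 1) (trans (five x) x≡) (trans (sym x≡) (five′ x))
        refl (≤-trans (<⇒≤ (≰⇒> δ<32)) (m≤m+n 32 32)) L≤2x
  where
  x = L ∸ 5
  5≤L : 5 ≤ L
  5≤L = ≤-trans (m≤m+n 5 23) 28≤L
  x≡ : 5 + x ≡ L
  x≡ = m+[n∸m]≡n 5≤L
  five : ∀ x → 3 + (x + 1) + 1 ≡ 5 + x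
  five = solve-∀
  five′ : ∀ x → 5 + x ≡ 4 + (x + 1)
  five′ = solve-∀
  L≤2x : L ≤ 2 * x
  L≤2x = begin
    L              ≡⟨ x≡ ⟨
    5 + x          ≤⟨ +-monoˡ-≤ x (≤-trans (m≤m+n 5 18) (+-cancelˡ-≤ 5 23 x (≤-trans 28≤L (≤-reflexive (sym x≡))))) ⟩
    x + x          ≡⟨ cong (x +_) (+-identityʳ x) ⟨
    2 * x          ∎
    where open ≤-Reasoning
... | yes 32≤δ = parameters (Lindström.scheme t room) t x (2 * (1 + 4 * t) + x + 1) (trans (eq₁ x t) x≡) (trans (sym x≡) (eq₂ x t))
        rate δ≤64t L≤2x
  where
  open ≤-Reasoning
  t = δ / 32
  δ≡ : δ ≡ δ % 32 + t * 32
  δ≡ = m≡m%n+[m/n]*n δ 32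
  32t≤δ : t * 32 ≤ δ
  32t≤δ = subst (t * 32 ≤_) (sym δ≡) (m≤n+m (t * 32) (δ % 32))
  δ< : δ < 32 + t * 32
  δ< = subst (_< 32 + t * 32) (sym δ≡) (+-monoˡ-< (t * 32) (m%n<n δ 32))
  t>0 : 0 < t
  t>0 = *-cancelʳ-< 32 0 t (+-cancelˡ-< 32 0 (t * 32) (≤-<-trans 32≤δ δ<))
  δ≤64t : δ ≤ 64 * t
  δ≤64t = begin
    δ                ≤⟨ <⇒≤ δ< ⟩
    32 + t * 32      ≤⟨ +-monoˡ-≤ (t * 32) (*-monoˡ-≤ 32 t>0) ⟩
    t * 32 + t * 32  ≡⟨ sixty-four t ⟩
    64 * t           ∎
    where
    sixty-four : ∀ t → t * 32 + t * 32 ≡ 64 * t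
    sixty-four = solve-∀
  room : 2 + 4 * t + t < δ
  room = begin-strict
    2 + 4 * t + t    ≡⟨ five t ⟩
    2 + 5 * t        <⟨ +-monoˡ-< (5 * t) (s≤s (s≤s (s≤s (z≤n {0})))) ⟩
    3 + 5 * t        ≤⟨ +-monoˡ-≤ (5 * t) (*-monoʳ-≤ 3 t>0) ⟩
    3 * t + 5 * t    ≤⟨ m≤m+n _ (24 * t) ⟩
    3 * t + 5 * t + 24 * t ≡⟨ thirty-two t ⟩
    t * 32           ≤⟨ 32t≤δ ⟩
    δ                ∎
    where
    five : ∀ t → 2 + 4 * t + t ≡ 2 + 5 * t
    five = solve-∀
    thirty-two : ∀ t → 3 * t + 5 * t + 24 * t ≡ t * 32
    thirty-two = solve-∀
  half : 14 + 16 * t ≤ L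
  half = *-cancelˡ-≤ 2 (begin
    2 * (14 + 16 * t)  ≡⟨ expand t ⟩
    28 + t * 32        ≤⟨ +-mono-≤ 28≤L (≤-trans 32t≤δ δ≤L) ⟩
    L + L              ≡⟨ cong (L +_) (+-identityʳ L) ⟨
    2 * L              ∎)
    where
    expand : ∀ t → 2 * (14 + 16 * t) ≡ 28 + t * 32
    expand = solve-∀
  used = 7 + 8 * t
  half≡ : ∀ t → 14 + 16 * t ≡ (7 + 8 * t) + (7 + 8 * t)
  half≡ = solve-∀
  x = L ∸ used
  used≤x : used ≤ x
  used≤x = m+n≤o⇒m≤o∸n used (subst (_≤ L) (half≡ t) half)
  x≡ : used + x ≡ L
  x≡ = m+[n∸m]≡n (≤-trans used≤x (m∸n≤m L used))
  eq₁ : ∀ x t → 3 + (x + (2 + 4 * t)) + (2 + 4 * t) ≡ (7 + 8 * t) + x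
  eq₁ = solve-∀
  eq₂ : ∀ x t → (7 + 8 * t) + x ≡ 4 + (2 * (1 + 4 * t) + x + 1)
  eq₂ = solve-∀
  exponent : ∀ x t → (1 + 4 * t) + (x + (2 + 4 * t)) ≡ 2 * (1 + 4 * t) + x + 1
  exponent = solve-∀
  rate : t * 2 ^ (1 + 4 * t) * 2 ^ (x + (2 + 4 * t)) ≡ t * 2 ^ (2 * (1 + 4 * t) + x + 1)
  rate = trans (*-assoc t _ _) (cong (t *_) (trans (sym (^-distribˡ-+-* 2 (1 + 4 * t) _)) (cong (2 ^_) (exponent x t))))
  L≤2x : L ≤ 2 * x
  L≤2x = begin
    L              ≡⟨ x≡ ⟨
    used + x       ≤⟨ +-monoˡ-≤ x used≤x ⟩
    x + x          ≡⟨ cong (x +_) (+-identityʳ x) ⟨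
    2 * x          ∎

theorem1 : Σ ℕ λ cn → Σ ℕ λ cd → Σ ℕ λ n₀ → (0 < cn) × (0 < cd) ×
    ((n δ w : ℕ) → n₀ ≤ n → 1 ≤ δ → δ ≤ ⌊log₂ n ⌋ → n ≤ 2 ^ w →
    Σ (Vec (Sym δ) n) λ F → Σ (Vec (Sym δ) n) λ S₀ →
    (k : ℕ) (A : Fin (suc k) → Algorithm δ w) →
    ((r : Fin (suc k)) → Solves F S₀ (A r)) →
    Σ (Vec (Sym δ) n) λ xs →
    cn * δ * ⌊log₂ n ⌋ * n * suc k
    ≤ cd * w * sumFin (suc k) (λ r → cost (A r) (toList xs)))
-- 4096 is 64 * 2 * 32, from `δ ≤ 64 * rate`, `L ≤ 2 * levels` and `n ≤ 32 * 2 ^ y`; the 6 comes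
-- from the transfer bound, and `2 ^ 28` gives the 28 levels that the choice of parameters asks for.
theorem1 = 1 , 4096 * 6 , 2 ^ 28 , s≤s z≤n , s≤s z≤n , λ n δ w n₀≤n 1≤δ δ≤L n≤2^w →
  bound n δ w (log-lower 28 n₀≤n) (chooseParameters δ ⌊log₂ n ⌋ (log-lower 28 n₀≤n) 1≤δ δ≤L) (<-≤-trans (2^>0 28) n₀≤n) n≤2^w
  where
  bound : ∀ n δ w → 28 ≤ ⌊log₂ n ⌋ → Parameters δ ⌊log₂ n ⌋ → 0 < n → n ≤ 2 ^ w →
    Σ (Vec (Sym δ) n) λ F → Σ (Vec (Sym δ) n) λ S₀ →
    (K : ℕ) (A : Fin (suc K) → Algorithm δ w) →
    ((r : Fin (suc K)) → Solves F S₀ (A r)) →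
    Σ (Vec (Sym δ) n) λ xs →
    1 * δ * ⌊log₂ n ⌋ * n * suc K ≤ 4096 * 6 * w * sumFin (suc K) (λ r → cost (A r) (toList xs))
  bound n δ w 28≤L (parameters S rate x y levels-eq top-eq rate-eq δ≤ L≤) n>0 n≤2^w =
    window n G , window n (background S) , λ K A solves →
      let xs , le = randomised-lower S n w w>0 x fits K A solves
      in xs , scale K (sumFin (suc K) (λ r → cost (A r) (toList xs))) le
    where
    open Scheme S
    open ≤-Reasoning
    L = ⌊log₂ n ⌋
    w>0 : 0 < w
    w>0 = begin-strict
      0                ≤⟨ z≤n {27} ⟩
      27               <⟨ 28≤L ⟩
      L                ≤⟨ ⌊log₂⌋-mono-≤ n≤2^w ⟩
      ⌊log₂ 2 ^ w ⌋    ≡⟨ ⌊log₂[2^n]⌋≡n w ⟩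
      w                ∎
    fits : 2 ^ (3 + (x + k)) * m ≤ n
    fits = begin
      2 ^ (3 + (x + k)) * m  ≡⟨ ^-distribˡ-+-* 2 (3 + (x + k)) k ⟨
      2 ^ (3 + (x + k) + k)  ≡⟨ cong (2 ^_) levels-eq ⟩
      2 ^ L                  ≤⟨ 2^log≤n n n>0 ⟩
      n                      ∎
    n≤ : n ≤ 32 * 2 ^ y
    n≤ = begin
      n                ≤⟨ <⇒≤ (n<2^[1+log] n) ⟩
      2 ^ suc L        ≡⟨ cong (λ a → 2 ^ suc a) top-eq ⟩
      2 ^ (5 + y)      ≡⟨ ^-distribˡ-+-* 2 5 y ⟩
      32 * 2 ^ y       ∎
    collect : ∀ r x p → 64 * r * (2 * x) * (32 * p) ≡ 4096 * (x * (r * p))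
    collect = solve-∀
    β = x * e * 2 ^ (x + k)
    total : δ * L * n ≤ 4096 * β
    total = begin
      δ * L * n                              ≤⟨ *-mono-≤ (*-mono-≤ δ≤ L≤) n≤ ⟩
      64 * rate * (2 * x) * (32 * 2 ^ y)     ≡⟨ collect rate x (2 ^ y) ⟩
      4096 * (x * (rate * 2 ^ y))            ≡⟨ cong (λ z → 4096 * (x * z)) rate-eq ⟨
      4096 * (x * (e * 2 ^ (x + k)))         ≡⟨ cong (4096 *_) (*-assoc x e _) ⟨
      4096 * β                               ∎
    scale : ∀ K s → suc K * β ≤ 6 * w * s → 1 * δ * L * n * suc K ≤ 4096 * 6 * w * s
    scale K s le = begin
      1 * δ * L * n * suc K    ≡⟨ cong (λ d → d * L * n * suc K) (*-identityˡ δ) ⟩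
      δ * L * n * suc K        ≤⟨ *-monoˡ-≤ (suc K) total ⟩
      4096 * β * suc K         ≡⟨ trans (*-assoc 4096 β (suc K)) (cong (4096 *_) (*-comm β (suc K))) ⟩
      4096 * (suc K * β)       ≤⟨ *-monoʳ-≤ 4096 le ⟩
      4096 * (6 * w * s)       ≡⟨ cong (4096 *_) (*-assoc 6 w s) ⟩
      4096 * (6 * (w * s))     ≡⟨ *-assoc 4096 6 (w * s) ⟨
      4096 * 6 * (w * s)       ≡⟨ *-assoc (4096 * 6) w s ⟨
      4096 * 6 * w * s         ∎
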